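{- Let $q=p^m$ be a power of an odd prime $p$, and let $N_\alpha$ $(\alpha\in\mathbb{F}_q)$ be the $(0,1)$-matrices of order $(2q+3)q^2$ defined in the context. (1) For $\alpha\in\mathbb{F}_q$, $$N_\alpha N_\alpha^t=2q^2I_{q^2(2q+3)}+2qJ_{q^2(2q+3)}+q\sum_{a\in\mathbb{F}_q\cup\{y\}}\left(V^{2\varphi(a)}+V^{ -2\varphi(a)}\right)\otimes C_{a,0}.$$ (2) $N_0$ is the adjacency matrix of a Deza graph with parameters $(q^2(2q+3),\,2q^2+2q,\,3q,\,2q)$. (3) For every $\alpha\in\mathbb{F}_q^*=\mathbb{F}_q\setminus\{0\}$, $N_\alpha$ is the adjacency matrix of a directed Deza graph of type II with parameters $(q^2(2q+3),\,2q^2+2q,\,3q,\,2q)$.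
   Context: $I_r$ and $J_r$ are the identity and all-ones matrices of order $r$, and $\otimes$ is the Kronecker product. Identify the additive group of $\mathbb{F}_q$ with $\mathbb{F}_p^m$. Let $U=\mathrm{circ}(0,1,0,\ldots,0)$ be the circulant matrix of order $p$ with first row $(0,1,0,\ldots,0)$, and define the group homomorphism $\phi:\mathbb{F}_q\to GL_q(\mathbb{R})$ by $\phi((x_i)_{i=1}^m)=\bigotimes_{i=1}^mU^{x_i}$. For $\alpha,\alpha'\in\mathbb{F}_q$ let $C_{\alpha,\alpha'}$ be the $q^2\times q^2$ $(0,1)$-matrix which is a $q\times q$ block matrix, with blocks indexed by $\beta,\beta'\in\mathbb{F}_q$, whose $(\beta,\beta')$-block is $\phi(\alpha(-\beta+\beta')+\alpha')$. Let $y$ be an additional symbol not in $\mathbb{F}_q$ and put $C_{y,\alpha}=\phi(\alpha)\otimes J_q$ for $\alpha\in\mathbb{F}_q$. Let $x$ be a further symbol and let $L$ be the circulant matrix of order $2q+3$ with first row $(a_1,\ldots,a_{2q+3})$, where $a_1=x$, $a_2=y$, $\{a_i:3\le i\le q+2\}=\mathbb{F}_q$, and $a_{2q+4-i}=a_{i+1}$ for $1\le i\le 2q+2$ (so $L$ is symmetric). Write $L=\sum_{a\in\mathbb{F}_q\cup\{x,y\}}a\cdot P_a$ with $(0,1)$-matrices $P_a$; thus $P_x=I_{2q+3}$. Let $V$ be the shift matrix (the circulant matrix with first row $(0,1,0,\ldots,0)$) of order $2q+3$ and let $\varphi:\mathbb{F}_q\cup\{y\}\to\{1,\ldots,q+1\}$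 be the bijection with $P_a=V^{\varphi(a)}+V^{ -\varphi(a)}$. For $\alpha\in\mathbb{F}_q$ define $N_\alpha=\sum_{a\in\mathbb{F}_q\cup\{y\}}P_a\otimes C_{a,\alpha}$. A Deza graph with parameters $(n,k,b,a)$, $a\le b$, is a $k$-regular simple graph on $n$ vertices such that any two distinct vertices have $a$ or $b$ common neighbours. A digraph (no loops, at most one arc from one vertex to another) is a directed Deza graph of type II with parameters $(n,k,b,a)$, where $0\le a\le b\le k\le n$, if it has $n$ vertices, every vertex has in-degree and out-degree $k$, and for any distinct vertices $u,v$ the number of vertices $w$ with $u\rightarrow w\leftarrow v$ and the number of vertices $w$ with $u\leftarrow w\rightarrow v$ coincide and equal $a$ or $b$. The adjacency matrix has $(i,j)$-entry $1$ iff $i\rightarrow j$. -}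

module Defs where

open import Algebra.Apartness.Structures using (IsHeytingField)
import Algebra.Properties.Semiring.Sum as Sum
open import Data.Bool.Base using (if_then_else_)
open import Data.Fin.Base using (Fin; zero; suc; toℕ; quotient; remainder)
open import Data.Fin.Properties using () renaming (_≟_ to _≟ᶠ_)
open import Data.Integer.Base as ℤ using (ℤ; +_; -[1+_])
open import Data.Nat.Base using (ℕ; zero; suc; _+_; _*_; _∸_; _^_; _≤_; NonZero)
open import Data.Nat.DivMod using (_mod_)
open import Data.Nat.Properties using (_≟_; +-*-semiring)
open import Data.Product.Base using (_×_; ∃-syntax)
open import Data.Sum.Base using (_⊎_)
open import Data.Vec.Base using (Vec; []; _∷_; allFin; count; zipWith)
open import Data.Vec.Functional using (Vector)
import Data.Vec.Properties as Vec
open import Function.Bundles using (_↔_; _⤖_; Bijection; Inverse)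
open import Function.Properties.Inverse using (↔⇒↣)
open import Level using (0ℓ)
open import Relation.Binary.Core using (Rel)
open import Relation.Binary.Definitions using (Decidable; DecidableEquality; Irreflexive; Symmetric)
open import Relation.Binary.PropositionalEquality using (_≡_; _≢_; refl; cong)
open import Relation.Nullary.Decidable
  using (Dec; yes; no; does; map′; _×-dec_; via-injection)
open import Relation.Unary using (Pred) renaming (Decidable to Decidable₁)

------------------------------------------------------------------------
-- Matrices
--
-- Every matrix in the construction has nonnegative integer entries and is
-- formed by sums and products only, so entries are taken in ℕ (⊂ ℝ).

Matrix : ℕ → Set
Matrix n = Fin n → Fin n → ℕ

open Sum +-*-semiring public using (sum)

𝟙 : ∀ {p} {P : Set p} → Dec P → ℕ
𝟙 P? = if does P? then 1 else 0

infix  4 _≐_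
infixl 6 _⊕_
infixl 7 _·_ _⊙_
infixr 7 _⊗_
infixr 8 _^ᴹ_
infix  9 _ᵗ

_≐_ : ∀ {n} → Matrix n → Matrix n → Set
A ≐ B = ∀ i j → A i j ≡ B i j

I J : ∀ n → Matrix n
I n i j = 𝟙 (i ≟ᶠ j)
J n i j = 1

_⊕_ _·_ : ∀ {n} → Matrix n → Matrix n → Matrix n
(A ⊕ B) i j = A i j + B i j
(A · B) i j = sum (λ k → A i k * B k j)

_⊙_ : ∀ {n} → ℕ → Matrix n → Matrix n
(c ⊙ A) i j = c * A i j

_ᵗ : ∀ {n} → Matrix n → Matrix n
(A ᵗ) i j = A j i

_^ᴹ_ : ∀ {n} → Matrix n → ℕ → Matrix n
A ^ᴹ zero  = I _
A ^ᴹ suc k = A · A ^ᴹ k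

-- The r × r block matrix with blocks of order s.
blocks : ∀ {r s} → (Fin r → Fin r → Matrix s) → Matrix (r * s)
blocks {r} {s} B i j =
  B (quotient {r} s i) (quotient {r} s j) (remainder {r} s i) (remainder {r} s j)

_⊗_ : ∀ {r s} → Matrix r → Matrix s → Matrix (r * s)
A ⊗ B = blocks (λ β β′ → A β β′ ⊙ B)

-- The circulant array with the given first row; its (i , j)-entry is the
-- entry of the row at position j - i modulo n.
circ : ∀ {A : Set} {n} .{{_ : NonZero n}} → Vector A n → Fin n → Fin n → A
circ {n = n} row i j = row ((toℕ j + (n ∸ toℕ i)) mod n)

-- circ(0,1,0,…,0)
shift : ∀ n .{{_ : NonZero n}} → Matrix n
shift n = circ (λ k → 𝟙 (toℕ k ≟ 1))

-- Integer powers of a permutation matrix, whose inverse is its transpose;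
-- not meaningful for other matrices.
_^ᴾ_ : ∀ {n} → Matrix n → ℤ → Matrix n
A ^ᴾ (+ k)    = A ^ᴹ k
A ^ᴾ -[1+ k ] = A ᵗ ^ᴹ suc k

infixr 8 _^ᴾ_

------------------------------------------------------------------------
-- Graphs and digraphs on Fin n

∣_∣ : ∀ {n} {P : Pred (Fin n) 0ℓ} → Decidable₁ P → ℕ
∣ P? ∣ = count P? (allFin _)

adjacencyMatrix : ∀ {n} {R : Rel (Fin n) 0ℓ} → Decidable R → Matrix n
adjacencyMatrix R? i j = 𝟙 (R? i j)

record Graph (n : ℕ) : Set₁ where
  field
    _∼_    : Rel (Fin n) 0ℓ
    _∼?_   : Decidable _∼_
    irrefl : Irreflexive _≡_ _∼_
    sym    : Symmetric _∼_

record Digraph (n : ℕ) : Set₁ where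
  field
    _⟶_    : Rel (Fin n) 0ℓ
    _⟶?_   : Decidable _⟶_
    irrefl : Irreflexive _≡_ _⟶_

record IsDeza {v} (G : Graph v) (n k b a : ℕ) : Set where
  open Graph G
  field
    order   : v ≡ n
    a≤b     : a ≤ b
    regular : ∀ u → ∣ (λ w → u ∼? w) ∣ ≡ k
    common  : ∀ u v → u ≢ v →
              let c = ∣ (λ w → (u ∼? w) ×-dec (v ∼? w)) ∣ in
              c ≡ a ⊎ c ≡ b

record IsDirectedDezaII {v} (G : Digraph v) (n k b a : ℕ) : Set where
  open Digraph G
  field
    order      : v ≡ n
    a≤b        : a ≤ b
    b≤k        : b ≤ k
    k≤n        : k ≤ n
    outRegular : ∀ u → ∣ (λ w → u ⟶? w) ∣ ≡ k
    inRegular  : ∀ u → ∣ (λ w → w ⟶? u) ∣ ≡ k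
    common     : ∀ u v → u ≢ v →
                 let out = ∣ (λ w → (u ⟶? w) ×-dec (v ⟶? w)) ∣
                     inn = ∣ (λ w → (w ⟶? u) ×-dec (w ⟶? v)) ∣
                 in out ≡ inn × (out ≡ a ⊎ out ≡ b)

------------------------------------------------------------------------
-- 𝔽_q with q = p ^ m

-- A field with propositional equality is a Heyting field whose apartness
-- is _≢_ (this includes 0# ≢ 1#, hence m ≥ 1 below).  The identification
-- of the additive group with 𝔽_p^m is an arbitrary additive bijection
-- `coords`; `elem` is an arbitrary enumeration, giving the order in which
-- elements of 𝔽_q index the rows and columns of block matrices.
record FiniteField (p m : ℕ) .{{_ : NonZero p}} : Set₁ where
  infixl 6 _+ᶠ_
  infixl 7 _*ᶠ_
  infix  8 -ᶠ_
  field
    Carrier        : Set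
    _+ᶠ_ _*ᶠ_      : Carrier → Carrier → Carrier
    -ᶠ_            : Carrier → Carrier
    0# 1#          : Carrier
    isHeytingField : IsHeytingField _≡_ _≢_ _+ᶠ_ _*ᶠ_ -ᶠ_ 0# 1#
    coords         : Carrier ↔ Vec (Fin p) m
    coords-+       : ∀ α β → Inverse.to coords (α +ᶠ β) ≡
                     zipWith (λ i j → (toℕ i + toℕ j) mod p)
                             (Inverse.to coords α) (Inverse.to coords β)
    elem           : Fin (p ^ m) ↔ Carrier

  _≟ᴷ_ : DecidableEquality Carrier
  _≟ᴷ_ = via-injection (↔⇒↣ coords) (Vec.≡-dec _≟ᶠ_)

-- 𝔽_q ∪ {𝕪}
data Colour (K : Set) : Set where
  𝕪   : Colour K
  elt : K → Colour K

-- 𝔽_q ∪ {𝕩 , 𝕪}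
data Symbol (K : Set) : Set where
  𝕩   : Symbol K
  col : Colour K → Symbol K

module _ {K : Set} (_≟ᴷ_ : DecidableEquality K) where

  ≟-colour : DecidableEquality (Colour K)
  ≟-colour 𝕪       𝕪       = yes refl
  ≟-colour 𝕪       (elt _) = no λ ()
  ≟-colour (elt _) 𝕪       = no λ ()
  ≟-colour (elt α) (elt β) = map′ (cong elt) (λ { refl → refl }) (α ≟ᴷ β)

  ≟-symbol : DecidableEquality (Symbol K)
  ≟-symbol 𝕩       𝕩       = yes refl
  ≟-symbol 𝕩       (col _) = no λ ()
  ≟-symbol (col _) 𝕩       = no λ ()
  ≟-symbol (col a) (col b) = map′ (cong col) (λ { refl → refl }) (≟-colour a b)

-- Admissible first rows (a₁ , … , a_{2q+3}) of L.  Positions are counted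
-- from 0 here, so a_{i+1} is `a i` and the condition a_{2q+4-i} = a_{i+1}
-- relates positions whose sum is 2q+3.
record IsFirstRow {K : Set} (q : ℕ) (a : Vector (Symbol K) (3 + 2 * q)) : Set where
  field
    first      : a zero ≡ 𝕩
    second     : a (suc zero) ≡ col 𝕪
    fieldPart  : ∀ i → 2 ≤ toℕ i → toℕ i ≤ q + 1 → ∃[ α ] a i ≡ col (elt α)
    fieldAll   : ∀ α → ∃[ i ] (2 ≤ toℕ i × toℕ i ≤ q + 1 × a i ≡ col (elt α))
    palindrome : ∀ i j → toℕ i + toℕ j ≡ 3 + 2 * q → a i ≡ a j

------------------------------------------------------------------------
-- The matrices N_α

module Construction
  {p m : ℕ} .{{_ : NonZero p}} (𝔽 : FiniteField p m)
  (a : Vector (Symbol (FiniteField.Carrier 𝔽)) (3 + 2 * p ^ m))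
  where

  open FiniteField 𝔽 public

  q ℓ : ℕ
  q = p ^ m
  ℓ = 3 + 2 * q

  U : Matrix p
  U = shift p

  ⨂U : ∀ {k} → Vec (Fin p) k → Matrix (p ^ k)
  ⨂U []       = I 1
  ⨂U (i ∷ is) = U ^ᴹ toℕ i ⊗ ⨂U is

  ϕ : Carrier → Matrix q
  ϕ α = ⨂U (Inverse.to coords α)

  C : Colour Carrier → Carrier → Matrix (q * q)
  C (elt α) α′ = blocks λ i j →
    let β = Inverse.to elem i ; β′ = Inverse.to elem j in
    ϕ (α *ᶠ (-ᶠ β +ᶠ β′) +ᶠ α′)
  C 𝕪       α  = ϕ α ⊗ J q

  L : Fin ℓ → Fin ℓ → Symbol Carrier
  L = circ a

  P : Symbol Carrier → Matrix ℓ
  P s i j = 𝟙 (≟-symbol _≟ᴷ_ (L i j) s)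

  V : Matrix ℓ
  V = shift ℓ

  Σ-colour : ∀ {n} → (Colour Carrier → Matrix n) → Matrix n
  Σ-colour M i j = M 𝕪 i j + sum (λ k → M (elt (Inverse.to elem k)) i j)

  N : Carrier → Matrix (ℓ * (q * q))
  N α = Σ-colour λ c → P (col c) ⊗ C c α

  -- Fin (1 + q) stands for {1, …, q+1}, hence the suc.
  value : Colour Carrier ⤖ Fin (1 + q) → Colour Carrier → ℕ
  value φ c = suc (toℕ (Bijection.to φ c))

  IsExponent : Colour Carrier ⤖ Fin (1 + q) → Set
  IsExponent φ = ∀ c →
    P (col c) ≐ V ^ᴾ (+ value φ c) ⊕ V ^ᴾ (ℤ.- + value φ c)

{-# OPTIONS --safe #-}
module Submission where

-- Index C_{a,α} by points of the affine plane over 𝔽_q: for α = 0 its ones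
-- join points along lines of slope a, and C_{y,0} plays the role of the
-- vertical direction.  Two lines of different slopes meet in one point, so
-- C_{c,α} C_{d,α}ᵗ = J for c ≠ d, while C_{c,α} C_{c,α}ᵗ = q C_{c,0}; two
-- points lie on one line, so Σ_c C_{c,0} = J + q I.  With P_c² = V^{2φ(c)} + V^{-2φ(c)} + 2 I and
-- Σ_c P_c = J - I, expanding N_α N_αᵗ gives (1).  As 2q + 3 is odd, halving
-- residues turns Σ_c (V^{2φ(c)} + V^{-2φ(c)}) into Σ_c P_c, so the last sum in
-- (1) is a (0,1)-matrix with zero diagonal; this gives degrees and numbers of
-- common neighbours.  Since N_αᵗ = N_{-α} and (1) does not depend on α, also
-- N_αᵗ N_α = N_α N_αᵗ.

open import Defs
open import Algebra.Apartness.Structures using (IsHeytingField)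
open import Algebra.Bundles using (CommutativeRing)
import Algebra.Properties.Group as GroupProperties
import Algebra.Solver.Ring.NaturalCoefficients.Default as SemiringSolver
open import Data.Bool.Base using (true; false)
open import Data.Fin.Base using (Fin; zero; suc; toℕ; fromℕ<; _↑ˡ_; _↑ʳ_; combine; quotient; remainder)
open import Data.Fin.Properties
  using (remQuot-combine; combine-remQuot; suc-injective; toℕ-fromℕ<; toℕ<n; toℕ-injective)
  renaming (_≟_ to _≟ᶠ_)
open import Data.Integer.Base as ℤ using ()
open import Data.List.Base using ([]; _∷_)
open import Data.Nat.Base
open import Data.Nat.Divisibility using (_∤_)
open import Data.Nat.DivMod
open import Data.Nat.Primality using (Prime; prime⇒nonTrivial)
open import Data.Nat.Properties hiding (suc-injective)
open import Data.Nat.Tactic.RingSolver using (solve)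
open import Data.Product.Base using (_×_; _,_; proj₁; proj₂; uncurry; ∃-syntax)
open import Data.Sum.Base using (_⊎_; inj₁; inj₂)
open import Data.Vec.Base using (Vec; tabulate; count; zipWith)
open import Data.Vec.Functional using (Vector)
import Data.Vec.Properties as VecP
open import Function.Base using (_∘_; id)
open import Function.Bundles using (_↔_; _⤖_; Inverse; mk⇔; mk↔ₛ′)
open import Function.Construct.Composition using (_↔-∘_)
open import Function.Construct.Symmetry using (↔-sym)
open import Level using (0ℓ)
open import Relation.Binary.PropositionalEquality hiding (J)
open import Relation.Nullary.Decidable
  using (Dec; yes; no; does; _×-dec_; dec-true; dec-false; does-⇔; decidable-stable)
open import Relation.Nullary.Negation using (¬_; contradiction)
open import Relation.Unary using (Pred) renaming (Decidable to Decidable₁)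
open import Algebra.Properties.Semiring.Sum +-*-semiring
  using (sum-cong-≗; ∑-distrib-+; ∑-comm; *-distribˡ-sum; *-distribʳ-sum; sum-replicate-zero)

open ≡-Reasoning

-- The field carries two unrelated numberings. Inside a block, an index is read through its base-`p`
-- digits and `coords`, because that is how the tensor product `ϕ α` acts; the blocks themselves are
-- numbered by the arbitrary `elem`. But `C 𝕪 α` is `ϕ α ⊗ J q`, so it reads the block index through
-- digits as well. The vertical direction survives this mismatch: for shift 0 it only asks for equal
-- block indices, which any bijection detects, and against a finite slope it only has to single out
-- one block. The shift `α` enters both factors of a Gram product in the same way and cancels, which
-- is why (1) has the same right-hand side for all `α`. Entries are natural numbers, so identities
-- that would involve differences of matrices are stated with the negative terms moved across and
-- are cancelled only at the end.

private variable
  X Y : Set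
  n : ℕ

-- Indicators and finite sums

𝟙-cong : (P? : Dec X) (Q? : Dec Y) → (X → Y) → (Y → X) → 𝟙 P? ≡ 𝟙 Q?
𝟙-cong P? Q? f g rewrite does-⇔ (mk⇔ f g) P? Q? = refl

𝟙-true : (P? : Dec X) → X → 𝟙 P? ≡ 1
𝟙-true P? p rewrite dec-true P? p = refl

𝟙-false : (P? : Dec X) → ¬ X → 𝟙 P? ≡ 0
𝟙-false P? ¬p rewrite dec-false P? ¬p = refl

𝟙-× : (P? : Dec X) (Q? : Dec Y) → 𝟙 P? * 𝟙 Q? ≡ 𝟙 (P? ×-dec Q?)
𝟙-× P? Q? with does P? | does Q?
... | false | _     = refl
... | true  | false = refl
... | true  | true  = refl

𝟙≤1 : (P? : Dec X) → 𝟙 P? ≤ 1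
𝟙≤1 P? with does P?
... | false = z≤n
... | true  = ≤-refl

𝟙-≡1 : ∀ {k} → k ≤ 1 → k ≡ 𝟙 (k ≟ 1)
𝟙-≡1 z≤n       = refl
𝟙-≡1 (s≤s z≤n) = refl

sum-cong : ∀ n {f g : Fin n → ℕ} → (∀ k → f k ≡ g k) → sum f ≡ sum g
sum-cong n = sum-cong-≗ {n}

sum-swap : ∀ m n (f : Fin m → Fin n → ℕ) →
           sum (λ i → sum (λ j → f i j)) ≡ sum (λ j → sum (λ i → f i j))
sum-swap m n = ∑-comm {m} {n}

sum-≡0 : (f : Fin n → ℕ) → (∀ k → f k ≡ 0) → sum f ≡ 0
sum-≡0 {n} f f≡0 = trans (sum-cong-≗ f≡0) (sum-replicate-zero n)

sum-mono-≤ : (f g : Fin n → ℕ) → (∀ k → f k ≤ g k) → sum f ≤ sum g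
sum-mono-≤ {zero}  f g f≤g = z≤n
sum-mono-≤ {suc n} f g f≤g =
  +-mono-≤ (f≤g zero) (sum-mono-≤ (f ∘ suc) (g ∘ suc) (f≤g ∘ suc))

sum-const : ∀ n c → sum {n} (λ _ → c) ≡ n * c
sum-const zero    c = refl
sum-const (suc n) c = cong (c +_) (sum-const n c)

-- Phrased for any condition with a unique solution rather than for `k ≡ k₀`, so that it applies
-- directly to equations in `k` such as the meeting of two lines.
sum-𝟙* : {P : Fin n → Set} (P? : ∀ k → Dec (P k)) (k₀ : Fin n) → P k₀ →
         (∀ k → P k → k ≡ k₀) → (f : Fin n → ℕ) →
         sum (λ k → 𝟙 (P? k) * f k) ≡ f k₀
sum-𝟙* P? zero p₀ unique f = begin
  𝟙 (P? zero) * f zero + sum (λ k → 𝟙 (P? (suc k)) * f (suc k))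
    ≡⟨ cong₂ _+_ (cong (_* f zero) (𝟙-true (P? zero) p₀))
         (sum-≡0 _ λ k → cong (_* f (suc k))
            (𝟙-false (P? (suc k)) λ p → contradiction (unique _ p) λ ())) ⟩
  f zero + 0 + 0
    ≡⟨ trans (+-identityʳ _) (+-identityʳ _) ⟩
  f zero ∎
sum-𝟙* P? (suc k₀) p₀ unique f =
  cong₂ _+_
    (cong (_* f zero) (𝟙-false (P? zero) λ p → contradiction (unique _ p) λ ()))
    (sum-𝟙* (P? ∘ suc) k₀ p₀ (λ k p → suc-injective (unique (suc k) p)) (f ∘ suc))

sum-𝟙 : {P : Fin n → Set} (P? : ∀ k → Dec (P k)) (k₀ : Fin n) → P k₀ →
        (∀ k → P k → k ≡ k₀) → sum (λ k → 𝟙 (P? k)) ≡ 1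
sum-𝟙 {n} P? k₀ p₀ unique =
  trans (sum-cong n λ k → sym (*-identityʳ _)) (sum-𝟙* P? k₀ p₀ unique λ _ → 1)

sum-++ : ∀ m (f : Fin (m + n) → ℕ) →
         sum f ≡ sum (λ i → f (i ↑ˡ n)) + sum (λ j → f (m ↑ʳ j))
sum-++ zero    f = refl
sum-++ (suc m) f = trans (cong (f zero +_) (sum-++ m (f ∘ suc))) (sym (+-assoc (f zero) _ _))

sum-combine : ∀ r s (f : Fin (r * s) → ℕ) →
              sum f ≡ sum (λ i → sum (λ j → f (combine {r} {s} i j)))
sum-combine zero    s f = refl
sum-combine (suc r) s f =
  trans (sum-++ s f) (cong (sum (λ j → f (j ↑ˡ r * s)) +_) (sum-combine r s (λ k → f (s ↑ʳ k))))

sum-remQuot : ∀ r s (f : Fin r → Fin s → ℕ) →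
              sum (λ k → f (quotient {r} s k) (remainder {r} s k)) ≡ sum (λ i → sum (f i))
sum-remQuot r s f = begin
  sum (λ k → f (quotient {r} s k) (remainder {r} s k))
    ≡⟨ sum-combine r s _ ⟩
  sum (λ i → sum (λ j → f (quotient {r} s (combine {r} {s} i j)) (remainder {r} s (combine {r} {s} i j))))
    ≡⟨ sum-cong r (λ i → sum-cong s λ j → cong (uncurry f) (remQuot-combine i j)) ⟩
  sum (λ i → sum (f i)) ∎

remQuot-injective : ∀ r s (i j : Fin (r * s)) → quotient {r} s i ≡ quotient {r} s j →
                    remainder {r} s i ≡ remainder {r} s j → i ≡ j
remQuot-injective r s i j eq₁ eq₂ =
  trans (sym (combine-remQuot {r} s i)) (trans (cong₂ combine eq₁ eq₂) (combine-remQuot {r} s j))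

I-blocks : ∀ r s → I (r * s) ≐ I r ⊗ I s
I-blocks r s i j = trans
  (𝟙-cong (i ≟ᶠ j) ((quotient {r} s i ≟ᶠ quotient {r} s j) ×-dec (remainder {r} s i ≟ᶠ remainder {r} s j))
    (λ eq → cong (quotient {r} s) eq , cong (remainder {r} s) eq)
    (uncurry (remQuot-injective r s i j)))
  (sym (𝟙-× (quotient {r} s i ≟ᶠ quotient {r} s j) (remainder {r} s i ≟ᶠ remainder {r} s j)))

-- The mixed-product rule for Kronecker products, entrywise: the product of a sum of `A_c ⊗ X_c`
-- with the transpose of a sum of `B_d ⊗ Y_d` is the sum of `A_c B_dᵗ ⊗ X_c Y_dᵗ` over all pairs.
sum-sum-*-sum : ∀ {r s k} (a b : Fin k → Fin r → ℕ) (x y : Fin k → Fin s → ℕ) →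
  sum (λ i → sum (λ j → sum (λ c → a c i * x c j) * sum (λ d → b d i * y d j))) ≡
  sum (λ c → sum (λ d → sum (λ i → a c i * b d i) * sum (λ j → x c j * y d j)))
sum-sum-*-sum {r} {s} {k} a b x y = begin
  sum (λ i → sum (λ j → sum (λ c → a c i * x c j) * sum (λ d → b d i * y d j)))
    ≡⟨ sum-cong r (λ i → sum-cong s λ j → product (λ c → a c i * x c j) (λ d → b d i * y d j)) ⟩
  sum (λ i → sum (λ j → sum (λ c → sum (λ d → a c i * x c j * (b d i * y d j)))))
    ≡⟨ sum-cong r (λ i → sum-swap s k _) ⟩
  sum (λ i → sum (λ c → sum (λ j → sum (λ d → a c i * x c j * (b d i * y d j)))))
    ≡⟨ sum-swap r k _ ⟩
  sum (λ c → sum (λ i → sum (λ j → sum (λ d → a c i * x c j * (b d i * y d j)))))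
    ≡⟨ sum-cong k (λ c → sum-cong r λ i → sum-swap s k _) ⟩
  sum (λ c → sum (λ i → sum (λ d → sum (λ j → a c i * x c j * (b d i * y d j)))))
    ≡⟨ sum-cong k (λ c → sum-swap r k _) ⟩
  sum (λ c → sum (λ d → sum (λ i → sum (λ j → a c i * x c j * (b d i * y d j)))))
    ≡⟨ sum-cong k (λ c → sum-cong k λ d → sum-cong r λ i → sum-cong s λ j →
         [m*n]*[o*p]≡[m*o]*[n*p] (a c i) (x c j) (b d i) (y d j)) ⟩
  sum (λ c → sum (λ d → sum (λ i → sum (λ j → a c i * b d i * (x c j * y d j)))))
    ≡⟨ sum-cong k (λ c → sum-cong k λ d → sym (product (λ i → a c i * b d i) (λ j → x c j * y d j))) ⟩
  sum (λ c → sum (λ d → sum (λ i → a c i * b d i) * sum (λ j → x c j * y d j))) ∎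
  where
  product : ∀ {m n} (f : Fin m → ℕ) (g : Fin n → ℕ) →
            sum f * sum g ≡ sum (λ i → sum (λ j → f i * g j))
  product {m} f g = trans (*-distribʳ-sum (sum g) f) (sum-cong m λ i → *-distribˡ-sum (f i) g)

count-tabulate : {A : Set} {P : Pred A 0ℓ} (P? : Decidable₁ P) (f : Fin n → A) →
                 count P? (tabulate f) ≡ sum (λ k → 𝟙 (P? (f k)))
count-tabulate {n = zero}  P? f = refl
count-tabulate {n = suc n} P? f with does (P? (f zero))
... | true  = cong suc (count-tabulate P? (f ∘ suc))
... | false = count-tabulate P? (f ∘ suc)

∣∣≡sum : {P : Pred (Fin n) 0ℓ} (P? : Decidable₁ P) → ∣ P? ∣ ≡ sum (λ k → 𝟙 (P? k))
∣∣≡sum P? = count-tabulate P? id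

-- Residues modulo `n` and powers of the shift matrix

module Cyclic (n : ℕ) .{{_ : NonZero n}} where

  infixl 6 _⊞_
  _⊞_ : Fin n → ℕ → Fin n
  i ⊞ k = (toℕ i + k) mod n

  -- Literally the index used in `circ`, so `circ row i j` is `row (difference i j)` by computation.
  difference : Fin n → Fin n → Fin n
  difference i j = (toℕ j + (n ∸ toℕ i)) mod n

  toℕ-mod : ∀ k → toℕ (k mod n) ≡ k % n
  toℕ-mod k = toℕ-fromℕ< (m%n<n k n)

  mod-cong : ∀ k l → k % n ≡ l % n → k mod n ≡ l mod n
  mod-cong k l eq = toℕ-injective (trans (toℕ-mod k) (trans eq (sym (toℕ-mod l))))

  toℕ-%n : ∀ (i : Fin n) → toℕ i % n ≡ toℕ i
  toℕ-%n i = m<n⇒m%n≡m (toℕ<n i)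

  toℕ-mod-toℕ : ∀ (i : Fin n) → toℕ i mod n ≡ i
  toℕ-mod-toℕ i = toℕ-injective (trans (toℕ-mod (toℕ i)) (toℕ-%n i))

  [m%n+k]%n : ∀ m k → (m % n + k) % n ≡ (m + k) % n
  [m%n+k]%n m k = begin
    (m % n + k) % n          ≡⟨ %-distribˡ-+ (m % n) k n ⟩
    (m % n % n + k % n) % n  ≡⟨ cong (λ x → (x + k % n) % n) (m%n%n≡m%n m n) ⟩
    (m % n + k % n) % n      ≡⟨ sym (%-distribˡ-+ m k n) ⟩
    (m + k) % n              ∎

  mod-⊞ : ∀ m k → m mod n ⊞ k ≡ (m + k) mod n
  mod-⊞ m k = mod-cong _ (m + k)
    (trans (cong (λ x → (x + k) % n) (toℕ-mod m)) ([m%n+k]%n m k))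

  ⊞-⊞ : ∀ i k l → i ⊞ k ⊞ l ≡ i ⊞ (k + l)
  ⊞-⊞ i k l = trans (mod-⊞ (toℕ i + k) l) (cong (_mod n) (+-assoc (toℕ i) k l))

  ⊞-*n : ∀ i k → i ⊞ (k * n) ≡ i
  ⊞-*n i k = trans (mod-cong _ _ ([m+kn]%n≡m%n (toℕ i) k n)) (toℕ-mod-toℕ i)

  -- A representative of `- k` modulo `n` that avoids truncated subtraction: `k + k * (n ∸ 1)` is a
  -- multiple of `n` for every `k`, also beyond `n`.
  neg : ℕ → ℕ
  neg k = k * (n ∸ 1)

  k+neg-k : ∀ k → k + neg k ≡ k * n
  k+neg-k k = trans (sym (*-suc k (n ∸ 1))) (cong (k *_) (suc-pred n))

  ⊞-neg : ∀ i k → i ⊞ k ⊞ neg k ≡ i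
  ⊞-neg i k = trans (⊞-⊞ i k (neg k)) (trans (cong (i ⊞_) (k+neg-k k)) (⊞-*n i k))

  neg-⊞ : ∀ i k → i ⊞ neg k ⊞ k ≡ i
  neg-⊞ i k = trans (⊞-⊞ i (neg k) k)
    (trans (cong (i ⊞_) (trans (+-comm (neg k) k) (k+neg-k k))) (⊞-*n i k))

  ⊞-injective : ∀ {i j} k → i ⊞ k ≡ j ⊞ k → i ≡ j
  ⊞-injective {i} {j} k eq = trans (sym (⊞-neg i k)) (trans (cong (_⊞ neg k) eq) (⊞-neg j k))

  ⊞-difference : ∀ i j → i ⊞ toℕ (difference i j) ≡ j
  ⊞-difference i j = begin
    i ⊞ toℕ (difference i j)
      ≡⟨ cong (_mod n) (+-comm (toℕ i) _) ⟩
    difference i j ⊞ toℕ i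
      ≡⟨ mod-⊞ (toℕ j + (n ∸ toℕ i)) (toℕ i) ⟩
    (toℕ j + (n ∸ toℕ i) + toℕ i) mod n
      ≡⟨ cong (_mod n) (trans (+-assoc (toℕ j) _ _)
           (cong (λ x → toℕ j + x) (trans (m∸n+n≡m (<⇒≤ (toℕ<n i))) (sym (*-identityˡ n))))) ⟩
    j ⊞ (1 * n)
      ≡⟨ ⊞-*n j 1 ⟩
    j ∎

  ⊞-difference≡0 : ∀ {i j} → toℕ (difference i j) ≡ 0 → i ≡ j
  ⊞-difference≡0 {i} {j} eq = trans (sym (⊞-*n i 0)) (trans (cong (i ⊞_) (sym eq)) (⊞-difference i j))

  difference-⊞ : ∀ i k → toℕ (difference i (i ⊞ k)) ≡ k % n
  difference-⊞ i k = begin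
    toℕ (i ⊞ k ⊞ (n ∸ toℕ i))
      ≡⟨ cong toℕ (⊞-⊞ i k (n ∸ toℕ i)) ⟩
    toℕ (i ⊞ (k + (n ∸ toℕ i)))
      ≡⟨ toℕ-mod _ ⟩
    (toℕ i + (k + (n ∸ toℕ i))) % n
      ≡⟨ cong (_% n) (trans (rotate (toℕ i) k (n ∸ toℕ i))
           (cong (k +_) (m∸n+n≡m (<⇒≤ (toℕ<n i))))) ⟩
    (k + n) % n
      ≡⟨ [m+n]%n≡m%n k n ⟩
    k % n ∎
    where
    rotate : ∀ a b c → a + (b + c) ≡ b + (c + a)
    rotate a b c = solve (a ∷ b ∷ c ∷ [])

  difference-self : ∀ i → toℕ (difference i i) ≡ 0
  difference-self i = trans (cong (λ j → toℕ (difference i j)) (sym (⊞-*n i 0)))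
    (trans (difference-⊞ i 0) (m<n⇒m%n≡m (>-nonZero⁻¹ n)))

  -- The pattern of V^k + V^(-k).
  W : ℕ → Matrix n
  W k i j = 𝟙 (i ⊞ k ≟ᶠ j) + 𝟙 (j ⊞ k ≟ᶠ i)

  W-sym : ∀ k i j → W k i j ≡ W k j i
  W-sym k i j = +-comm (𝟙 (i ⊞ k ≟ᶠ j)) _

  W-W : ∀ k i j → sum (λ l → W k i l * W k j l) ≡ W (2 * k) i j + 2 * 𝟙 (i ≟ᶠ j)
  W-W k i j = begin
    sum (λ l → (A i l + B i l) * (A j l + B j l))
      -- Each group starts with an indicator that determines `l`. In the cross term `A j l` leads,
      -- giving `l = j ⊞ k` and the condition `j ⊞ k ⊞ k ≡ i` without any `neg`.
      ≡⟨ sum-cong n (λ l → expand (A i l) (B i l) (A j l) (B j l)) ⟩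
    sum (λ l → A i l * (A j l + B j l) + (A j l * B i l + B i l * B j l))
      ≡⟨ ∑-distrib-+ (λ l → A i l * (A j l + B j l)) _ ⟩
    sum (λ l → A i l * (A j l + B j l)) + sum (λ l → A j l * B i l + B i l * B j l)
      ≡⟨ cong₂ _+_ (from i _) (trans (∑-distrib-+ (λ l → A j l * B i l) _) (cong₂ _+_ (from j _) (to i _))) ⟩
    A j (i ⊞ k) + B j (i ⊞ k) + (B i (j ⊞ k) + B j (i ⊞ neg k))
      ≡⟨ cong₂ (λ x y → x + y) (cong₂ _+_ δ₁ (double i j)) (cong₂ _+_ (double j i) δ₂) ⟩
    𝟙 (i ≟ᶠ j) + 𝟙 (i ⊞ 2 * k ≟ᶠ j) + (𝟙 (j ⊞ 2 * k ≟ᶠ i) + 𝟙 (i ≟ᶠ j))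
      ≡⟨ collect (𝟙 (i ≟ᶠ j)) _ _ ⟩
    W (2 * k) i j + 2 * 𝟙 (i ≟ᶠ j) ∎
    where
    A B : Matrix n
    A x l = 𝟙 (x ⊞ k ≟ᶠ l)
    B x l = 𝟙 (l ⊞ k ≟ᶠ x)
    expand : ∀ a b c d → (a + b) * (c + d) ≡ a * (c + d) + (c * b + b * d)
    expand a b c d = solve (a ∷ b ∷ c ∷ d ∷ [])
    collect : ∀ a b c → a + b + (c + a) ≡ b + c + 2 * a
    collect a b c = solve (a ∷ b ∷ c ∷ [])
    from : ∀ x (f : Fin n → ℕ) → sum (λ l → A x l * f l) ≡ f (x ⊞ k)
    from x f = sum-𝟙* (λ l → x ⊞ k ≟ᶠ l) (x ⊞ k) refl (λ _ → sym) f
    to : ∀ x (f : Fin n → ℕ) → sum (λ l → B x l * f l) ≡ f (x ⊞ neg k)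
    to x f = sum-𝟙* (λ l → l ⊞ k ≟ᶠ x) (x ⊞ neg k) (neg-⊞ x k)
      (λ l eq → trans (sym (⊞-neg l k)) (cong (_⊞ neg k) eq)) f
    δ₁ : A j (i ⊞ k) ≡ 𝟙 (i ≟ᶠ j)
    δ₁ = 𝟙-cong (j ⊞ k ≟ᶠ i ⊞ k) (i ≟ᶠ j) (λ eq → sym (⊞-injective k eq)) (λ eq → cong (_⊞ k) (sym eq))
    δ₂ : B j (i ⊞ neg k) ≡ 𝟙 (i ≟ᶠ j)
    δ₂ = 𝟙-cong (i ⊞ neg k ⊞ k ≟ᶠ j) (i ≟ᶠ j) (trans (sym (neg-⊞ i k))) (trans (neg-⊞ i k))
    twice : ∀ x → x ⊞ k ⊞ k ≡ x ⊞ 2 * k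
    twice x = trans (⊞-⊞ x k k) (cong (λ m → x ⊞ (k + m)) (sym (+-identityʳ k)))
    double : ∀ x y → B y (x ⊞ k) ≡ 𝟙 (x ⊞ 2 * k ≟ᶠ y)
    double x y = cong (λ z → 𝟙 (z ≟ᶠ y)) (twice x)

  -- For odd n, multiplication by h = (n + 1)/2 halves residues mod n, and so
  -- carries the pattern of exponent 2k to that of exponent k.
  module Halving (h : ℕ) (2h≡1+n : 2 * h ≡ 1 + n) where

    half : Fin n → Fin n
    half i = (toℕ i * h) mod n

    ⊞-half : ∀ i → half i ⊞ toℕ (half i) ≡ i
    ⊞-half i = begin
      half i ⊞ toℕ (half i)                 ≡⟨ mod-⊞ (toℕ i * h) _ ⟩
      (toℕ i * h + toℕ (half i)) mod n      ≡⟨ cong (_mod n) (+-comm (toℕ i * h) _) ⟩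
      half i ⊞ (toℕ i * h)                  ≡⟨ mod-⊞ (toℕ i * h) _ ⟩
      (toℕ i * h + toℕ i * h) mod n         ≡⟨ cong (_mod n) (trans (double (toℕ i) h) (cong (toℕ i *_) 2h≡1+n)) ⟩
      (toℕ i * (1 + n)) mod n               ≡⟨ cong (_mod n) (*-suc (toℕ i) n) ⟩
      i ⊞ (toℕ i * n)                       ≡⟨ ⊞-*n i (toℕ i) ⟩
      i                                     ∎
      where
      double : ∀ a b → a * b + a * b ≡ a * (2 * b)
      double a b = solve (a ∷ b ∷ [])

    half-injective : ∀ {i j} → half i ≡ half j → i ≡ j
    half-injective {i} {j} eq =
      trans (sym (⊞-half i)) (trans (cong (λ x → x ⊞ toℕ x) eq) (⊞-half j))

    half-⊞ : ∀ i k → half (i ⊞ 2 * k) ≡ half i ⊞ k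
    half-⊞ i k = begin
      half (i ⊞ 2 * k)
        ≡⟨ mod-cong _ _ (trans (%-distribˡ-* (toℕ (i ⊞ 2 * k)) h n)
             (trans (cong (λ x → (x * (h % n)) % n)
               (trans (cong (_% n) (toℕ-mod (toℕ i + 2 * k))) (m%n%n≡m%n _ n)))
             (sym (%-distribˡ-* (toℕ i + 2 * k) h n)))) ⟩
      ((toℕ i + 2 * k) * h) mod n
        ≡⟨ cong (_mod n) (trans (rearrange (toℕ i) k h) (cong (λ x → toℕ i * h + k * x) 2h≡1+n)) ⟩
      (toℕ i * h + k * (1 + n)) mod n
        ≡⟨ cong (_mod n) (trans (cong (λ x → toℕ i * h + x) (*-suc k n)) (sym (+-assoc (toℕ i * h) k _))) ⟩
      (toℕ i * h + k + k * n) mod n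
        ≡⟨ mod-cong _ _ ([m+kn]%n≡m%n (toℕ i * h + k) k n) ⟩
      (toℕ i * h + k) mod n
        ≡⟨ sym (mod-⊞ (toℕ i * h) k) ⟩
      half i ⊞ k ∎
      where
      rearrange : ∀ a b c → (a + 2 * b) * c ≡ a * c + b * (2 * c)
      rearrange a b c = solve (a ∷ b ∷ c ∷ [])

    W-half : ∀ k i j → W (2 * k) i j ≡ W k (half i) (half j)
    W-half k i j = cong₂ _+_ (entry i j) (entry j i)
      where
      entry : ∀ x y → 𝟙 (x ⊞ 2 * k ≟ᶠ y) ≡ 𝟙 (half x ⊞ k ≟ᶠ half y)
      entry x y = 𝟙-cong (x ⊞ 2 * k ≟ᶠ y) (half x ⊞ k ≟ᶠ half y)
        (λ eq → trans (sym (half-⊞ x k)) (cong half eq))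
        (λ eq → half-injective {x ⊞ 2 * k} (trans (half-⊞ x k) eq))

  -- For `n = 1` the first row has no position 1 and `shift 1` would be the zero matrix instead of a
  -- permutation matrix.
  module Shift (1<n : 1 < n) where

    shift≡ : ∀ i j → shift n i j ≡ 𝟙 (i ⊞ 1 ≟ᶠ j)
    shift≡ i j = 𝟙-cong (toℕ (difference i j) ≟ 1) (i ⊞ 1 ≟ᶠ j)
      (λ eq → trans (cong (i ⊞_) (sym eq)) (⊞-difference i j))
      (λ eq → trans (cong (λ x → toℕ (difference i x)) (sym eq))
        (trans (difference-⊞ i 1) (m<n⇒m%n≡m 1<n)))

    shift-^ : ∀ k i j → (shift n ^ᴹ k) i j ≡ 𝟙 (i ⊞ k ≟ᶠ j)
    shift-^ zero    i j = cong (λ x → 𝟙 (x ≟ᶠ j)) (sym (⊞-*n i 0))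
    shift-^ (suc k) i j = begin
      sum (λ l → shift n i l * (shift n ^ᴹ k) l j)
        ≡⟨ sum-cong n (λ l → cong₂ _*_ (shift≡ i l) (shift-^ k l j)) ⟩
      sum (λ l → 𝟙 (i ⊞ 1 ≟ᶠ l) * 𝟙 (l ⊞ k ≟ᶠ j))
        ≡⟨ sum-𝟙* (i ⊞ 1 ≟ᶠ_) (i ⊞ 1) refl (λ _ → sym) _ ⟩
      𝟙 (i ⊞ 1 ⊞ k ≟ᶠ j)
        ≡⟨ cong (λ x → 𝟙 (x ≟ᶠ j)) (⊞-⊞ i 1 k) ⟩
      𝟙 (i ⊞ suc k ≟ᶠ j) ∎

    shiftᵗ-^ : ∀ k i j → (shift n ᵗ ^ᴹ k) i j ≡ 𝟙 (j ⊞ k ≟ᶠ i)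
    shiftᵗ-^ zero    i j = 𝟙-cong (i ≟ᶠ j) (j ⊞ 0 ≟ᶠ i)
      (λ eq → trans (⊞-*n j 0) (sym eq)) (λ eq → sym (trans (sym (⊞-*n j 0)) eq))
    shiftᵗ-^ (suc k) i j = begin
      sum (λ l → shift n l i * (shift n ᵗ ^ᴹ k) l j)
        ≡⟨ sum-cong n (λ l → trans (cong₂ _*_ (shift≡ l i) (shiftᵗ-^ k l j)) (*-comm (𝟙 (l ⊞ 1 ≟ᶠ i)) _)) ⟩
      sum (λ l → 𝟙 (j ⊞ k ≟ᶠ l) * 𝟙 (l ⊞ 1 ≟ᶠ i))
        ≡⟨ sum-𝟙* (j ⊞ k ≟ᶠ_) (j ⊞ k) refl (λ _ → sym) _ ⟩
      𝟙 (j ⊞ k ⊞ 1 ≟ᶠ i)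
        ≡⟨ cong (λ x → 𝟙 (x ≟ᶠ i)) (trans (⊞-⊞ j k 1) (cong (j ⊞_) (+-comm k 1))) ⟩
      𝟙 (j ⊞ suc k ≟ᶠ i) ∎

    shift-^ᴾ- : ∀ k i j → (shift n ^ᴾ (ℤ.- ℤ.+ k)) i j ≡ 𝟙 (j ⊞ k ≟ᶠ i)
    -- Here `- + 0` computes to `+ 0`, so the power is taken of the shift itself; power zero is the
    -- identity for the transpose too.
    shift-^ᴾ- zero    i j = shiftᵗ-^ zero i j
    shift-^ᴾ- (suc k) i j = shiftᵗ-^ (suc k) i j

    shift-W : ∀ k → shift n ^ᴾ (ℤ.+ k) ⊕ shift n ^ᴾ (ℤ.- ℤ.+ k) ≐ W k
    shift-W k i j = cong₂ _+_ (shift-^ k i j) (shift-^ᴾ- k i j)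

-- The affine plane: sums over enumerated sets, lines and their intersections

module _ {n : ℕ} {A : Set} (enum : Fin n ↔ A) {P : A → Set} (P? : ∀ x → Dec (P x))
         (x₀ : A) (p₀ : P x₀) (unique : ∀ x → P x → x ≡ x₀) where

  open Inverse enum

  sum-↔-𝟙* : (f : A → ℕ) → sum (λ k → 𝟙 (P? (to k)) * f (to k)) ≡ f x₀
  sum-↔-𝟙* f = trans
    (sum-𝟙* (P? ∘ to) (from x₀) (subst P (sym (strictlyInverseˡ x₀)) p₀)
      (λ k p → trans (sym (strictlyInverseʳ k)) (cong from (unique (to k) p))) (f ∘ to))
    (cong f (strictlyInverseˡ x₀))

  sum-↔-𝟙 : sum (λ k → 𝟙 (P? (to k))) ≡ 1
  sum-↔-𝟙 = trans (sum-cong n λ k → sym (*-identityʳ _)) (sum-↔-𝟙* λ _ → 1)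

module FieldGeometry {p m : ℕ} .{{_ : NonZero p}} (𝔽 : FiniteField p m) where

  open FiniteField 𝔽
  open IsHeytingField isHeytingField
    using (isCommutativeRing; #⇒invertible; zeroʳ; -‿inverseˡ; -‿inverseʳ)
    renaming (+-assoc to +ᶠ-assoc; +-identityˡ to +ᶠ-identityˡ; +-identityʳ to +ᶠ-identityʳ;
              *-assoc to *ᶠ-assoc; *-comm to *ᶠ-comm; *-identityˡ to *ᶠ-identityˡ)

  ring : CommutativeRing 0ℓ 0ℓ
  ring = record { isCommutativeRing = isCommutativeRing }

  open GroupProperties (CommutativeRing.+-group ring) using (∙-cancelʳ)
  open SemiringSolver (CommutativeRing.commutativeSemiring ring)
    using (_:=_; _:+_; _:*_; con) renaming (solve to solveᶠ)

  telescope : ∀ i j k → (-ᶠ i +ᶠ j) +ᶠ (-ᶠ j +ᶠ k) ≡ -ᶠ i +ᶠ k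
  telescope i j k = begin
    (-ᶠ i +ᶠ j) +ᶠ (-ᶠ j +ᶠ k)
      ≡⟨ solveᶠ 4 (λ x y z w → (x :+ y) :+ (z :+ w) := x :+ ((z :+ y) :+ w)) refl (-ᶠ i) j (-ᶠ j) k ⟩
    -ᶠ i +ᶠ ((-ᶠ j +ᶠ j) +ᶠ k)
      ≡⟨ cong (λ x → -ᶠ i +ᶠ (x +ᶠ k)) (-‿inverseˡ j) ⟩
    -ᶠ i +ᶠ (0# +ᶠ k)
      ≡⟨ cong (-ᶠ i +ᶠ_) (+ᶠ-identityˡ k) ⟩
    -ᶠ i +ᶠ k ∎

  x+[-x+y]≡y : ∀ x y → x +ᶠ (-ᶠ x +ᶠ y) ≡ y
  x+[-x+y]≡y x y = trans (sym (+ᶠ-assoc x (-ᶠ x) y)) (trans (cong (_+ᶠ y) (-‿inverseʳ x)) (+ᶠ-identityˡ y))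

  -x+[x+y]≡y : ∀ x y → -ᶠ x +ᶠ (x +ᶠ y) ≡ y
  -x+[x+y]≡y x y = trans (sym (+ᶠ-assoc (-ᶠ x) x y)) (trans (cong (_+ᶠ y) (-‿inverseˡ x)) (+ᶠ-identityˡ y))

  -- Serves both incidence facts: with the abscissa as unknown it makes lines of different slopes
  -- meet once, with the slope as unknown it gives the one line joining points of different
  -- abscissae.
  affine-root : ∀ {c} → c ≢ 0# → ∀ u v → ∃[ x ] (u +ᶠ c *ᶠ x ≡ v × (∀ y → u +ᶠ c *ᶠ y ≡ v → y ≡ x))
  affine-root {c} c≢0 u v with #⇒invertible c≢0
  ... | d , d*c≡1 , c*d≡1 = x , root , unique
    where
    -- The Heyting field axiom inverts the difference of two apart elements, here `c - 0#`.
    c-0≡c : c +ᶠ (-ᶠ 0#) ≡ c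
    c-0≡c = trans (cong (c +ᶠ_) (trans (sym (+ᶠ-identityˡ _)) (-‿inverseʳ 0#))) (+ᶠ-identityʳ c)
    x = d *ᶠ (-ᶠ u +ᶠ v)
    root : u +ᶠ c *ᶠ x ≡ v
    root = begin
      u +ᶠ c *ᶠ (d *ᶠ (-ᶠ u +ᶠ v))  ≡⟨ cong (u +ᶠ_) (sym (*ᶠ-assoc c d _)) ⟩
      u +ᶠ (c *ᶠ d) *ᶠ (-ᶠ u +ᶠ v)  ≡⟨ cong (λ w → u +ᶠ w *ᶠ (-ᶠ u +ᶠ v)) (trans (cong (_*ᶠ d) (sym c-0≡c)) c*d≡1) ⟩
      u +ᶠ 1# *ᶠ (-ᶠ u +ᶠ v)        ≡⟨ cong (u +ᶠ_) (*ᶠ-identityˡ _) ⟩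
      u +ᶠ (-ᶠ u +ᶠ v)              ≡⟨ x+[-x+y]≡y u v ⟩
      v                             ∎
    unique : ∀ y → u +ᶠ c *ᶠ y ≡ v → y ≡ x
    unique y eq = begin
      y                                       ≡⟨ sym (*ᶠ-identityˡ y) ⟩
      1# *ᶠ y                                 ≡⟨ cong (_*ᶠ y) (trans (sym d*c≡1) (cong (d *ᶠ_) c-0≡c)) ⟩
      d *ᶠ c *ᶠ y                             ≡⟨ *ᶠ-assoc d c y ⟩
      d *ᶠ (c *ᶠ y)                           ≡⟨ cong (d *ᶠ_) (sym (-x+[x+y]≡y u (c *ᶠ y))) ⟩
      d *ᶠ (-ᶠ u +ᶠ (u +ᶠ c *ᶠ y))            ≡⟨ cong (λ w → d *ᶠ (-ᶠ u +ᶠ w)) eq ⟩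
      x                                       ∎

  difference≢0 : ∀ {x y} → x ≢ y → -ᶠ x +ᶠ y ≢ 0#
  difference≢0 {x} {y} x≢y eq =
    x≢y (trans (sym (+ᶠ-identityʳ x)) (trans (cong (x +ᶠ_) (sym eq)) (x+[-x+y]≡y x y)))

  -- The index (i , s) stands for the point (x i , y s) of the affine plane.
  -- C c α joins it to the points on a line of slope c when α = 0.  The
  -- matrices C 𝕪 α order the block rows by y rather than by x.
  module Counting {q : ℕ} (elems points : Fin q ↔ Carrier) where

    x y : Fin q → Carrier
    x = Inverse.to elems
    y = Inverse.to points

    x-injective : ∀ {i j} → x i ≡ x j → i ≡ j
    x-injective {i} {j} eq = trans (sym (Inverse.strictlyInverseʳ elems i))
      (trans (cong (Inverse.from elems) eq) (Inverse.strictlyInverseʳ elems j))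

    y-injective : ∀ {i j} → y i ≡ y j → i ≡ j
    y-injective {i} {j} eq = trans (sym (Inverse.strictlyInverseʳ points i))
      (trans (cong (Inverse.from points) eq) (Inverse.strictlyInverseʳ points j))

    Hit : Colour Carrier → Carrier → (i s j t : Fin q) → Set
    Hit 𝕪       α i s j t = y i +ᶠ α ≡ y j
    Hit (elt a) α i s j t = y s +ᶠ (a *ᶠ (-ᶠ x i +ᶠ x j) +ᶠ α) ≡ y t

    hit? : ∀ c α i s j t → Dec (Hit c α i s j t)
    hit? 𝕪       α i s j t = (y i +ᶠ α) ≟ᴷ y j
    hit? (elt a) α i s j t = (y s +ᶠ (a *ᶠ (-ᶠ x i +ᶠ x j) +ᶠ α)) ≟ᴷ y t

    Hit-transpose : ∀ c α i s j t → Hit c α i s j t → Hit c (-ᶠ α) j t i s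
    Hit-transpose 𝕪       α i s j t eq = begin
      y j +ᶠ (-ᶠ α)         ≡⟨ cong (_+ᶠ (-ᶠ α)) (sym eq) ⟩
      y i +ᶠ α +ᶠ (-ᶠ α)    ≡⟨ +ᶠ-assoc (y i) α (-ᶠ α) ⟩
      y i +ᶠ (α +ᶠ (-ᶠ α))  ≡⟨ cong (y i +ᶠ_) (-‿inverseʳ α) ⟩
      y i +ᶠ 0#             ≡⟨ +ᶠ-identityʳ (y i) ⟩
      y i                   ∎
    Hit-transpose (elt a) α i s j t eq = begin
      y t +ᶠ (a *ᶠ (-ᶠ x j +ᶠ x i) +ᶠ (-ᶠ α))
        ≡⟨ cong (_+ᶠ (a *ᶠ (-ᶠ x j +ᶠ x i) +ᶠ (-ᶠ α))) (sym eq) ⟩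
      y s +ᶠ (a *ᶠ (-ᶠ x i +ᶠ x j) +ᶠ α) +ᶠ (a *ᶠ (-ᶠ x j +ᶠ x i) +ᶠ (-ᶠ α))
        ≡⟨ solveᶠ 6 (λ e a u v β γ → e :+ (a :* u :+ β) :+ (a :* v :+ γ) := e :+ (a :* (u :+ v) :+ (β :+ γ)))
             refl (y s) a (-ᶠ x i +ᶠ x j) (-ᶠ x j +ᶠ x i) α (-ᶠ α) ⟩
      y s +ᶠ (a *ᶠ ((-ᶠ x i +ᶠ x j) +ᶠ (-ᶠ x j +ᶠ x i)) +ᶠ (α +ᶠ (-ᶠ α)))
        ≡⟨ cong₂ (λ u v → y s +ᶠ (a *ᶠ u +ᶠ v)) (trans (telescope (x i) (x j) (x i)) (-‿inverseˡ (x i)))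
             (-‿inverseʳ α) ⟩
      y s +ᶠ (a *ᶠ 0# +ᶠ 0#)
        ≡⟨ cong (y s +ᶠ_) (trans (+ᶠ-identityʳ _) (zeroʳ a)) ⟩
      y s +ᶠ 0#
        ≡⟨ +ᶠ-identityʳ (y s) ⟩
      y s ∎

    -- An entry of `C c α` times the transpose of `C c′ α`, with the summation index split into
    -- block `j` and offset `t`.
    common : (c c′ : Colour Carrier) (α : Carrier) (i s i′ s′ : Fin q) → ℕ
    common c c′ α i s i′ s′ = sum λ j → sum λ t →
      𝟙 (hit? c α i s j t) * 𝟙 (hit? c′ α i′ s′ j t)

    common-comm : ∀ c c′ α i s i′ s′ → common c c′ α i s i′ s′ ≡ common c′ c α i′ s′ i s
    common-comm c c′ α i s i′ s′ = sum-cong q λ j → sum-cong q λ t →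
      *-comm (𝟙 (hit? c α i s j t)) _

    sum-y : ∀ z (f : Carrier → ℕ) → sum (λ t → 𝟙 (z ≟ᴷ y t) * f (y t)) ≡ f z
    sum-y z f = sum-↔-𝟙* points (z ≟ᴷ_) z refl (λ _ → sym) f

    -- Lines of equal slope agree everywhere or nowhere. For a finite slope `t` is determined by
    -- `j`, and agreement at any `j` amounts to agreement at `x i′`, so `j` is free; for `𝕪` the
    -- block `j` is determined and `t` is free. Either way the factor is `q`.
    common-same : ∀ c α i s i′ s′ → common c c α i s i′ s′ ≡ q * 𝟙 (hit? c 0# i s i′ s′)
    common-same 𝕪 α i s i′ s′ = begin
      sum (λ j → sum {q} λ _ → 𝟙 ((y i +ᶠ α) ≟ᴷ y j) * 𝟙 ((y i′ +ᶠ α) ≟ᴷ y j))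
        ≡⟨ sum-swap q q _ ⟩
      sum {q} (λ _ → sum λ j → 𝟙 ((y i +ᶠ α) ≟ᴷ y j) * 𝟙 ((y i′ +ᶠ α) ≟ᴷ y j))
        ≡⟨ sum-cong q (λ _ → sum-y (y i +ᶠ α) λ z → 𝟙 ((y i′ +ᶠ α) ≟ᴷ z)) ⟩
      sum {q} (λ _ → 𝟙 ((y i′ +ᶠ α) ≟ᴷ (y i +ᶠ α)))
        ≡⟨ sum-const q _ ⟩
      q * 𝟙 ((y i′ +ᶠ α) ≟ᴷ (y i +ᶠ α))
        ≡⟨ cong (q *_) (𝟙-cong ((y i′ +ᶠ α) ≟ᴷ (y i +ᶠ α)) ((y i +ᶠ 0#) ≟ᴷ y i′)
             (λ eq → trans (+ᶠ-identityʳ (y i)) (sym (∙-cancelʳ α (y i′) (y i) eq)))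
             (λ eq → cong (_+ᶠ α) (trans (sym eq) (+ᶠ-identityʳ (y i))))) ⟩
      q * 𝟙 ((y i +ᶠ 0#) ≟ᴷ y i′) ∎
    common-same (elt a) α i s i′ s′ = begin
      sum (λ j → sum λ t → 𝟙 (u j ≟ᴷ y t) * 𝟙 (u′ j ≟ᴷ y t))
        ≡⟨ sum-cong q (λ j → sum-y (u j) λ z → 𝟙 (u′ j ≟ᴷ z)) ⟩
      sum (λ j → 𝟙 (u′ j ≟ᴷ u j))
        ≡⟨ sum-cong q (λ j → 𝟙-cong (u′ j ≟ᴷ u j) (v ≟ᴷ y s′)
             (λ eq → ∙-cancelʳ (w j) v (y s′) (trans (sym (shifted j)) (sym eq)))
             (λ eq → trans (cong (_+ᶠ w j) (sym eq)) (sym (shifted j)))) ⟩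
      sum {q} (λ _ → 𝟙 (v ≟ᴷ y s′))
        ≡⟨ sum-const q _ ⟩
      q * 𝟙 (v ≟ᴷ y s′) ∎
      where
      v : Carrier
      v = y s +ᶠ (a *ᶠ (-ᶠ x i +ᶠ x i′) +ᶠ 0#)
      u u′ w : Fin q → Carrier
      u  j = y s +ᶠ (a *ᶠ (-ᶠ x i +ᶠ x j) +ᶠ α)
      w  j = a *ᶠ (-ᶠ x i′ +ᶠ x j) +ᶠ α
      u′ j = y s′ +ᶠ w j
      shifted : ∀ j → u j ≡ v +ᶠ w j
      shifted j = begin
        y s +ᶠ (a *ᶠ (-ᶠ x i +ᶠ x j) +ᶠ α)
          ≡⟨ cong (λ z → y s +ᶠ (a *ᶠ z +ᶠ α)) (sym (telescope (x i) (x i′) (x j))) ⟩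
        y s +ᶠ (a *ᶠ ((-ᶠ x i +ᶠ x i′) +ᶠ (-ᶠ x i′ +ᶠ x j)) +ᶠ α)
          ≡⟨ solveᶠ 5 (λ e a s t α → e :+ (a :* (s :+ t) :+ α) := (e :+ (a :* s :+ con 0)) :+ (a :* t :+ α))
               refl (y s) a (-ᶠ x i +ᶠ x i′) (-ᶠ x i′ +ᶠ x j) α ⟩
        v +ᶠ w j ∎

    -- The vertical condition fixes the block `j`, and the line then fixes the offset `t`.
    common-𝕪-elt : ∀ a α i s i′ s′ → common 𝕪 (elt a) α i s i′ s′ ≡ 1
    common-𝕪-elt a α i s i′ s′ = begin
      sum (λ j → sum λ t → 𝟙 ((y i +ᶠ α) ≟ᴷ y j) * 𝟙 (u j ≟ᴷ y t))
        ≡⟨ sum-cong q (λ j → trans (sum-cong q λ t → *-comm (𝟙 ((y i +ᶠ α) ≟ᴷ y j)) _)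
             (sum-y (u j) λ _ → 𝟙 ((y i +ᶠ α) ≟ᴷ y j))) ⟩
      sum (λ j → 𝟙 ((y i +ᶠ α) ≟ᴷ y j))
        ≡⟨ sum-↔-𝟙 points ((y i +ᶠ α) ≟ᴷ_) (y i +ᶠ α) refl (λ _ → sym) ⟩
      1 ∎
      where
      u : Fin q → Carrier
      u j = y s′ +ᶠ (a *ᶠ (-ᶠ x i′ +ᶠ x j) +ᶠ α)

    common-elt-elt : ∀ {a a′} → a ≢ a′ → ∀ α i s i′ s′ → common (elt a) (elt a′) α i s i′ s′ ≡ 1
    common-elt-elt {a} {a′} a≢a′ α i s i′ s′ = begin
      sum (λ j → sum λ t → 𝟙 (u (x j) ≟ᴷ y t) * 𝟙 (u′ (x j) ≟ᴷ y t))
        ≡⟨ sum-cong q (λ j → sum-y (u (x j)) λ z → 𝟙 (u′ (x j) ≟ᴷ z)) ⟩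
      sum (λ j → 𝟙 (u′ (x j) ≟ᴷ u (x j)))
        ≡⟨ sum-↔-𝟙 elems (λ z → u′ z ≟ᴷ u z) (x i′ +ᶠ t₀)
             (trans (cong (_+ᶠ w (x i′ +ᶠ t₀)) (sym meet)) (sym (shifted (x i′ +ᶠ t₀))))
             (λ z eq → trans (sym (x+[-x+y]≡y (x i′) z)) (cong (x i′ +ᶠ_)
               (unique _ (∙-cancelʳ (w z) _ (y s′) (trans (sym (shifted z)) (sym eq)))))) ⟩
      1 ∎
      where
      -- `c` is the difference of the slopes, and `e₀` is the ordinate at `x i′` of the line of
      -- slope `a` through `(x i , y s)`. Subtracting the second line leaves
      -- `e₀ + c (z - x i′) = y s′`, where `α` has cancelled.
      c e₀ : Carrier
      c = -ᶠ a′ +ᶠ a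
      e₀ = y s +ᶠ a *ᶠ (-ᶠ x i +ᶠ x i′)
      u u′ w : Carrier → Carrier
      u  z = y s +ᶠ (a *ᶠ (-ᶠ x i +ᶠ z) +ᶠ α)
      w  z = a′ *ᶠ (-ᶠ x i′ +ᶠ z) +ᶠ α
      u′ z = y s′ +ᶠ w z
      shifted : ∀ z → u z ≡ (e₀ +ᶠ c *ᶠ (-ᶠ x i′ +ᶠ z)) +ᶠ w z
      shifted z = begin
        y s +ᶠ (a *ᶠ (-ᶠ x i +ᶠ z) +ᶠ α)
          ≡⟨ cong₂ (λ b d → y s +ᶠ (b *ᶠ d +ᶠ α)) (sym (x+[-x+y]≡y a′ a)) (sym (telescope (x i) (x i′) z)) ⟩
        y s +ᶠ ((a′ +ᶠ c) *ᶠ ((-ᶠ x i +ᶠ x i′) +ᶠ (-ᶠ x i′ +ᶠ z)) +ᶠ α)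
          ≡⟨ solveᶠ 6 (λ e a′ c s t α → e :+ ((a′ :+ c) :* (s :+ t) :+ α) :=
                                       ((e :+ (a′ :+ c) :* s) :+ c :* t) :+ (a′ :* t :+ α))
               refl (y s) a′ c (-ᶠ x i +ᶠ x i′) (-ᶠ x i′ +ᶠ z) α ⟩
        ((y s +ᶠ (a′ +ᶠ c) *ᶠ (-ᶠ x i +ᶠ x i′)) +ᶠ c *ᶠ (-ᶠ x i′ +ᶠ z)) +ᶠ w z
          ≡⟨ cong (λ b → ((y s +ᶠ b *ᶠ (-ᶠ x i +ᶠ x i′)) +ᶠ c *ᶠ (-ᶠ x i′ +ᶠ z)) +ᶠ w z) (x+[-x+y]≡y a′ a) ⟩
        (e₀ +ᶠ c *ᶠ (-ᶠ x i′ +ᶠ z)) +ᶠ w z ∎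
      solution : ∃[ t ] (e₀ +ᶠ c *ᶠ t ≡ y s′ × (∀ z → e₀ +ᶠ c *ᶠ z ≡ y s′ → z ≡ t))
      solution = affine-root (difference≢0 (λ eq → a≢a′ (sym eq))) e₀ (y s′)
      t₀ : Carrier
      t₀ = proj₁ solution
      unique = proj₂ (proj₂ solution)
      meet : e₀ +ᶠ c *ᶠ (-ᶠ x i′ +ᶠ (x i′ +ᶠ t₀)) ≡ y s′
      meet = trans (cong (λ z → e₀ +ᶠ c *ᶠ z) (-x+[x+y]≡y (x i′) t₀)) (proj₁ (proj₂ solution))

    common-distinct : ∀ {c c′} → c ≢ c′ → ∀ α i s i′ s′ → common c c′ α i s i′ s′ ≡ 1
    common-distinct {𝕪}     {𝕪}      c≢c′ α i s i′ s′ = contradiction refl c≢c′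
    common-distinct {𝕪}     {elt a}  c≢c′ α i s i′ s′ = common-𝕪-elt a α i s i′ s′
    common-distinct {elt a} {𝕪}      c≢c′ α i s i′ s′ =
      trans (common-comm (elt a) 𝕪 α i s i′ s′) (common-𝕪-elt a α i′ s′ i s)
    common-distinct {elt a} {elt a′} c≢c′ α i s i′ s′ =
      common-elt-elt (λ eq → c≢c′ (cong elt eq)) α i s i′ s′

    -- If `i ≡ i′`, the vertical direction contributes 1, and every finite slope hits exactly when
    -- `s ≡ s′`, which is the term `q`. Otherwise the vertical direction misses and the slope solves
    -- a linear equation whose coefficient `x i′ - x i` is nonzero.
    lines : ∀ i s i′ s′ →
      𝟙 (hit? 𝕪 0# i s i′ s′) + sum (λ k → 𝟙 (hit? (elt (x k)) 0# i s i′ s′)) ≡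
      1 + q * (𝟙 (i ≟ᶠ i′) * 𝟙 (s ≟ᶠ s′))
    lines i s i′ s′ = by-cases (i ≟ᶠ i′)
      where
      by-cases : (eq? : Dec (i ≡ i′)) →
        𝟙 (hit? 𝕪 0# i s i′ s′) + sum (λ k → 𝟙 (hit? (elt (x k)) 0# i s i′ s′)) ≡
        1 + q * (𝟙 eq? * 𝟙 (s ≟ᶠ s′))
      by-cases (yes refl) = cong₂ _+_
        (𝟙-true (hit? 𝕪 0# i s i s′) (+ᶠ-identityʳ (y i)))
        (trans
          (sum-cong q λ k → 𝟙-cong (hit? (elt (x k)) 0# i s i s′) (s ≟ᶠ s′)
            (λ eq → y-injective (trans (sym (on-line (x k))) eq))
            (λ eq → trans (on-line (x k)) (cong y eq)))
          (trans (sum-const q _) (cong (q *_) (sym (*-identityˡ _)))))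
        where
        on-line : ∀ a → y s +ᶠ (a *ᶠ (-ᶠ x i +ᶠ x i) +ᶠ 0#) ≡ y s
        on-line a = trans (cong (λ z → y s +ᶠ (a *ᶠ z +ᶠ 0#)) (-‿inverseˡ (x i)))
          (trans (cong (y s +ᶠ_) (trans (+ᶠ-identityʳ _) (zeroʳ a))) (+ᶠ-identityʳ (y s)))
      by-cases (no i≢i′) = trans
        (cong₂ _+_
          (𝟙-false (hit? 𝕪 0# i s i′ s′) (λ eq → i≢i′ (y-injective (trans (sym (+ᶠ-identityʳ (y i))) eq))))
          (sum-↔-𝟙 elems (λ a → hit? (elt a) 0# i s i′ s′) slope
            (trans (flip slope) (proj₁ (proj₂ solution)))
            (λ a eq → proj₂ (proj₂ solution) a (trans (sym (flip a)) eq))))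
        (cong (1 +_) (sym (*-zeroʳ q)))
        where
        solution = affine-root (difference≢0 (λ eq → i≢i′ (x-injective eq))) (y s) (y s′)
        slope = proj₁ solution
        flip : ∀ a → y s +ᶠ (a *ᶠ (-ᶠ x i +ᶠ x i′) +ᶠ 0#) ≡ y s +ᶠ (-ᶠ x i +ᶠ x i′) *ᶠ a
        flip a = cong (y s +ᶠ_) (trans (+ᶠ-identityʳ _) (*ᶠ-comm a _))

-- The Gram matrix of a sum of Kronecker products

-- Matrices P c summing to J - I.
Decomposes : ∀ {n κ} → (Fin κ → Matrix n) → Set
Decomposes P = ∀ i j → sum (λ c → P c i j) + 𝟙 (i ≟ᶠ j) ≡ 1

module _ {n κ : ℕ} (P : Fin κ → Matrix n) (total : Decomposes P) where

  -- Weights at most 1 cannot raise the sum above that of the `P c i j`, an entry of `J - I`. This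
  -- makes both `N α` and the last sum in (1) zero-one matrices.
  weighted≤1 : (e : Fin κ → ℕ) → (∀ c → e c ≤ 1) → ∀ i j → sum (λ c → P c i j * e c) ≤ 1
  weighted≤1 e e≤1 i j = ≤-trans
    (sum-mono-≤ (λ c → P c i j * e c) (λ c → P c i j)
      (λ c → ≤-trans (*-monoʳ-≤ (P c i j) (e≤1 c)) (≤-reflexive (*-identityʳ _))))
    (≤-trans (m≤m+n _ _) (≤-reflexive (total i j)))

  weighted-diagonal : (e : Fin κ → ℕ) → (∀ c → e c ≤ 1) → ∀ i → sum (λ c → P c i i * e c) ≡ 0
  weighted-diagonal e e≤1 i = n≤0⇒n≡0 (≤-trans
    (sum-mono-≤ (λ c → P c i i * e c) (λ c → P c i i)
      (λ c → ≤-trans (*-monoʳ-≤ (P c i i) (e≤1 c)) (≤-reflexive (*-identityʳ _))))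
    (≤-reflexive (+-cancelʳ-≡ 1 _ 0
      (trans (cong (λ x → sum (λ c → P c i i) + x) (sym (𝟙-true (i ≟ᶠ i) refl))) (total i i)))))

  -- (J - I)² = (n - 2) J + I
  [J-I]² : ∀ i j → sum (λ c → sum (λ d → sum (λ k → P c i k * P d j k))) + 2 ≡ n + 𝟙 (i ≟ᶠ j)
  [J-I]² i j = begin
    sum (λ c → sum (λ d → sum (λ k → P c i k * P d j k))) + 2
      ≡⟨ cong (_+ 2) regroup ⟩
    sum (λ k → A i k * A j k) + 2
      -- The 2 is absorbed as two row sums of the identity. What remains entrywise is (1 - x)(1 - y)
      -- = 1 - x - y + xy without subtraction, which is `complement`.
      ≡⟨ cong (λ x → sum (λ k → A i k * A j k) + x) (sym (cong₂ _+_ (row i) (row j))) ⟩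
    sum (λ k → A i k * A j k) + (sum (λ k → 𝟙 (i ≟ᶠ k)) + sum (λ k → 𝟙 (j ≟ᶠ k)))
      ≡⟨ cong (λ x → sum (λ k → A i k * A j k) + x) (sym (∑-distrib-+ (λ k → 𝟙 (i ≟ᶠ k)) _)) ⟩
    sum (λ k → A i k * A j k) + sum (λ k → 𝟙 (i ≟ᶠ k) + 𝟙 (j ≟ᶠ k))
      ≡⟨ sym (∑-distrib-+ (λ k → A i k * A j k) _) ⟩
    sum (λ k → A i k * A j k + (𝟙 (i ≟ᶠ k) + 𝟙 (j ≟ᶠ k)))
      ≡⟨ sum-cong n (λ k → complement (A i k) (A j k) _ _ (total i k) (total j k)) ⟩
    sum (λ k → 1 + 𝟙 (i ≟ᶠ k) * 𝟙 (j ≟ᶠ k))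
      ≡⟨ ∑-distrib-+ {n} (λ _ → 1) _ ⟩
    sum {n} (λ _ → 1) + sum (λ k → 𝟙 (i ≟ᶠ k) * 𝟙 (j ≟ᶠ k))
      ≡⟨ cong₂ _+_ (trans (sum-const n 1) (*-identityʳ n))
           (sum-𝟙* (i ≟ᶠ_) i refl (λ _ → sym) (λ k → 𝟙 (j ≟ᶠ k))) ⟩
    n + 𝟙 (j ≟ᶠ i)
      ≡⟨ cong (n +_) (𝟙-cong (j ≟ᶠ i) (i ≟ᶠ j) sym sym) ⟩
    n + 𝟙 (i ≟ᶠ j) ∎
    where
    A : Matrix n
    A i k = sum (λ c → P c i k)
    row : ∀ i → sum (λ k → 𝟙 (i ≟ᶠ k)) ≡ 1
    row i = sum-𝟙 (i ≟ᶠ_) i refl (λ _ → sym)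
    complement : ∀ a b x y → a + x ≡ 1 → b + y ≡ 1 → a * b + (x + y) ≡ 1 + x * y
    complement a b x y a+x≡1 b+y≡1 = begin
      a * b + (x + y)
        ≡⟨ cong₂ (λ u v → a * b + (u + v)) (sym (trans (cong (x *_) b+y≡1) (*-identityʳ x)))
             (sym (trans (cong (y *_) a+x≡1) (*-identityʳ y))) ⟩
      a * b + (x * (b + y) + y * (a + x))
        ≡⟨ solve (a ∷ b ∷ x ∷ y ∷ []) ⟩
      (a + x) * (b + y) + x * y
        ≡⟨ cong₂ (λ u v → u * v + x * y) a+x≡1 b+y≡1 ⟩
      1 + x * y ∎
    regroup : sum (λ c → sum (λ d → sum (λ k → P c i k * P d j k))) ≡ sum (λ k → A i k * A j k)
    regroup = begin
      sum (λ c → sum (λ d → sum (λ k → P c i k * P d j k)))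
        ≡⟨ sum-cong κ (λ c → sum-swap κ n (λ d k → P c i k * P d j k)) ⟩
      sum (λ c → sum (λ k → sum (λ d → P c i k * P d j k)))
        ≡⟨ sum-cong κ (λ c → sum-cong n λ k → sym (*-distribˡ-sum (P c i k) (λ d → P d j k))) ⟩
      sum (λ c → sum (λ k → P c i k * A j k))
        ≡⟨ sum-swap κ n (λ c k → P c i k * A j k) ⟩
      sum (λ k → sum (λ c → P c i k * A j k))
        ≡⟨ sum-cong n (λ k → sym (*-distribʳ-sum (A j k) (λ c → P c i k))) ⟩
      sum (λ k → A i k * A j k) ∎

-- Meant for `D c` = `C c α` and `E c` = `C c 0#`, so `α` is confined to `D`. Keeping `κ` a variable
-- equal to `1 + q` prevents the sums over colours from unfolding.
module Product
  {n s κ : ℕ} (q : ℕ) (n≡ : n ≡ 3 + 2 * q) (κ≡ : κ ≡ 1 + q)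
  {P W : Fin κ → Matrix n} (P-total : Decomposes P) (W-total : Decomposes W)
  (P-square : ∀ c i j → sum (λ k → P c i k * P c j k) ≡ W c i j + 2 * 𝟙 (i ≟ᶠ j))
  {D E : Fin κ → Matrix s}
  (D-same : ∀ c X Y → sum (λ Z → D c X Z * D c Y Z) ≡ q * E c X Y)
  (D-distinct : ∀ {c d} → c ≢ d → ∀ X Y → sum (λ Z → D c X Z * D d Y Z) ≡ 1)
  (E-total : ∀ X Y → sum (λ c → E c X Y) ≡ 1 + q * 𝟙 (X ≟ᶠ Y))
  where

  -- The sum of P_c P_dᵗ ⊗ D_c D_dᵗ over c ≢ d is compared with that of
  -- P_c P_dᵗ ⊗ J over all c and d.
  off-diagonal : (G K : Fin κ → Fin κ → ℕ) (e : Fin κ → ℕ) →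
    (∀ c → K c c ≡ e c) → (∀ {c d} → c ≢ d → K c d ≡ 1) →
    sum (λ c → sum (λ d → G c d * K c d)) + sum (λ c → G c c) ≡
    sum (λ c → G c c * e c) + sum (λ c → sum (λ d → G c d))
  off-diagonal G K e same distinct = begin
    sum (λ c → sum (λ d → G c d * K c d)) + sum (λ c → G c c)
      ≡⟨ sym (∑-distrib-+ (λ c → sum (λ d → G c d * K c d)) _) ⟩
    sum (λ c → sum (λ d → G c d * K c d) + G c c)
      ≡⟨ sum-cong κ row ⟩
    sum (λ c → G c c * e c + sum (λ d → G c d))
      ≡⟨ ∑-distrib-+ (λ c → G c c * e c) _ ⟩
    sum (λ c → G c c * e c) + sum (λ c → sum (λ d → G c d)) ∎
    where
    entry : ∀ c d → (eq? : Dec (c ≡ d)) → G c d * K c d + 𝟙 eq? * G c d ≡ 𝟙 eq? * (G c d * e c) + G c d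
    entry c d (yes refl) = cong₂ _+_
      (trans (cong (G c c *_) (same c)) (sym (*-identityˡ _))) (*-identityˡ (G c c))
    entry c d (no c≢d) = trans (+-identityʳ _)
      (trans (cong (G c d *_) (distinct c≢d)) (*-identityʳ (G c d)))
    row : ∀ c → sum (λ d → G c d * K c d) + G c c ≡ G c c * e c + sum (λ d → G c d)
    row c = begin
      sum (λ d → G c d * K c d) + G c c
        ≡⟨ cong (λ x → sum (λ d → G c d * K c d) + x) (sym (collapse (G c))) ⟩
      sum (λ d → G c d * K c d) + sum (λ d → 𝟙 (c ≟ᶠ d) * G c d)
        ≡⟨ sym (∑-distrib-+ (λ d → G c d * K c d) _) ⟩
      sum (λ d → G c d * K c d + 𝟙 (c ≟ᶠ d) * G c d)
        ≡⟨ sum-cong κ (λ d → entry c d (c ≟ᶠ d)) ⟩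
      sum (λ d → 𝟙 (c ≟ᶠ d) * (G c d * e c) + G c d)
        ≡⟨ ∑-distrib-+ (λ d → 𝟙 (c ≟ᶠ d) * (G c d * e c)) _ ⟩
      sum (λ d → 𝟙 (c ≟ᶠ d) * (G c d * e c)) + sum (λ d → G c d)
        ≡⟨ cong (_+ sum (λ d → G c d)) (collapse (λ d → G c d * e c)) ⟩
      G c c * e c + sum (λ d → G c d) ∎
      where
      collapse : (f : Fin κ → ℕ) → sum (λ d → 𝟙 (c ≟ᶠ d) * f d) ≡ f c
      collapse = sum-𝟙* (c ≟ᶠ_) c refl (λ _ → sym)

  gram : ∀ i j X Y →
    sum (λ k → sum (λ Z → sum (λ c → P c i k * D c X Z) * sum (λ d → P d j k * D d Y Z))) ≡
    2 * q ^ 2 * (𝟙 (i ≟ᶠ j) * 𝟙 (X ≟ᶠ Y)) + 2 * q * 1 + q * sum (λ c → W c i j * E c X Y)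
  gram i j X Y = trans (sum-sum-*-sum (λ c → P c i) (λ d → P d j) (λ c → D c X) (λ d → D d Y))
    (finish _ _ _ _ δ δ′ balance (W-total i j)
      (trans ([J-I]² P P-total i j) (cong (_+ δ) n≡)))
    where
    δ δ′ : ℕ
    δ  = 𝟙 (i ≟ᶠ j)
    δ′ = 𝟙 (X ≟ᶠ Y)
    G K : Fin κ → Fin κ → ℕ
    G c d = sum (λ k → P c i k * P d j k)
    K c d = sum (λ Z → D c X Z * D d Y Z)
    S w z T : ℕ
    S = sum (λ c → sum (λ d → G c d * K c d))
    w = sum (λ c → W c i j)
    z = sum (λ c → W c i j * E c X Y)
    T = sum (λ c → sum (λ d → G c d))

    trace : sum (λ c → G c c) ≡ w + (1 + q) * (2 * δ)
    trace = begin
      sum (λ c → G c c)                  ≡⟨ sum-cong κ (λ c → P-square c i j) ⟩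
      sum (λ c → W c i j + 2 * δ)        ≡⟨ ∑-distrib-+ (λ c → W c i j) _ ⟩
      w + sum {κ} (λ _ → 2 * δ)          ≡⟨ cong (w +_) (trans (sum-const κ (2 * δ)) (cong (_* (2 * δ)) κ≡)) ⟩
      w + (1 + q) * (2 * δ)              ∎

    weighted-trace : sum (λ c → G c c * (q * E c X Y)) ≡ q * z + 2 * δ * q * (1 + q * δ′)
    weighted-trace = begin
      sum (λ c → G c c * (q * E c X Y))
        ≡⟨ sum-cong κ (λ c → trans (cong (_* (q * E c X Y)) (P-square c i j)) (expand (W c i j) (E c X Y) δ)) ⟩
      sum (λ c → q * (W c i j * E c X Y) + 2 * δ * q * E c X Y)
        ≡⟨ ∑-distrib-+ (λ c → q * (W c i j * E c X Y)) _ ⟩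
      sum (λ c → q * (W c i j * E c X Y)) + sum (λ c → 2 * δ * q * E c X Y)
        ≡⟨ cong₂ _+_ (sym (*-distribˡ-sum q (λ c → W c i j * E c X Y)))
             (trans (sym (*-distribˡ-sum (2 * δ * q) (λ c → E c X Y)))
               (cong (2 * δ * q *_) (E-total X Y))) ⟩
      q * z + 2 * δ * q * (1 + q * δ′) ∎
      where
      expand : ∀ u e d → (u + 2 * d) * (q * e) ≡ q * (u * e) + 2 * d * q * e
      expand u e d = solve (u ∷ e ∷ d ∷ q ∷ [])

    balance : S + (w + (1 + q) * (2 * δ)) ≡ (q * z + 2 * δ * q * (1 + q * δ′)) + T
    balance = begin
      S + (w + (1 + q) * (2 * δ))              ≡⟨ cong (S +_) (sym trace) ⟩
      S + sum (λ c → G c c)                    ≡⟨ off-diagonal G K (λ c → q * E c X Y)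
                                                      (λ c → D-same c X Y) (λ c≢d → D-distinct c≢d X Y) ⟩
      sum (λ c → G c c * (q * E c X Y)) + T    ≡⟨ cong (_+ T) weighted-trace ⟩
      (q * z + 2 * δ * q * (1 + q * δ′)) + T   ∎

    finish : ∀ S w z T δ δ′ →
      S + (w + (1 + q) * (2 * δ)) ≡ (q * z + 2 * δ * q * (1 + q * δ′)) + T →
      w + δ ≡ 1 → T + 2 ≡ 3 + 2 * q + δ →
      S ≡ 2 * q ^ 2 * (δ * δ′) + 2 * q * 1 + q * z
    -- The cancelled term extends the left side of `balance` by `2 + δ`: the 2 completes `T + 2`,
    -- and `δ` completes `w + δ`. The later `q * (q * 1)` is `q ^ 2` unfolded.
    finish S w z T δ δ′ balance w+δ≡1 T+2≡ = +-cancelʳ-≡ (w + (1 + q) * (2 * δ) + (2 + δ)) _ _ (begin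
      S + (w + (1 + q) * (2 * δ) + (2 + δ))
        ≡⟨ sym (+-assoc S _ _) ⟩
      S + (w + (1 + q) * (2 * δ)) + (2 + δ)
        ≡⟨ cong (_+ (2 + δ)) balance ⟩
      (q * z + 2 * δ * q * (1 + q * δ′)) + T + (2 + δ)
        ≡⟨ solve (q ∷ z ∷ T ∷ δ ∷ δ′ ∷ []) ⟩
      (q * z + 2 * δ * q * (1 + q * δ′)) + (T + 2) + δ
        ≡⟨ cong (λ x → (q * z + 2 * δ * q * (1 + q * δ′)) + x + δ) T+2≡ ⟩
      (q * z + 2 * δ * q * (1 + q * δ′)) + (3 + 2 * q + δ) + δ
        ≡⟨ solve (q ∷ z ∷ δ ∷ δ′ ∷ []) ⟩
      2 * (q * (q * 1)) * (δ * δ′) + 2 * q * 1 + q * z + (1 + ((1 + q) * (2 * δ) + 2))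
        ≡⟨ cong (λ x → 2 * (q * (q * 1)) * (δ * δ′) + 2 * q * 1 + q * z + (x + ((1 + q) * (2 * δ) + 2))) (sym w+δ≡1) ⟩
      2 * (q * (q * 1)) * (δ * δ′) + 2 * q * 1 + q * z + (w + δ + ((1 + q) * (2 * δ) + 2))
        ≡⟨ solve (q ∷ z ∷ w ∷ δ ∷ δ′ ∷ []) ⟩
      2 * (q * (q * 1)) * (δ * δ′) + 2 * q * 1 + q * z + (w + (1 + q) * (2 * δ) + (2 + δ)) ∎)

-- From the Gram matrix to Deza graphs

-- The right-hand side of (1) with F for the sum over the colours.
gramForm : ∀ {v} → ℕ → Matrix v → Matrix v
gramForm q F x y = 2 * q ^ 2 * I _ x y + 2 * q * 1 + q * F x y

module Bounds (q : ℕ) .{{_ : NonZero q}} where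

  2q≤3q : 2 * q ≤ 3 * q
  2q≤3q = *-monoˡ-≤ q {2} {3} (s≤s (s≤s z≤n))

  -- With `q = 1 + r` the difference of the two sides is `1 + 3r + 2r²`, whose coefficients are
  -- nonnegative; the next bound is obtained in the same way.
  3q≤2q²+2q : 3 * q ≤ 2 * q ^ 2 + 2 * q
  3q≤2q²+2q = subst (λ n → 3 * n ≤ 2 * n ^ 2 + 2 * n) (suc-pred q)
    (≤-trans (m≤m+n _ (1 + 3 * pred q + 2 * (pred q * pred q))) (≤-reflexive (expand (pred q))))
    where
    expand : ∀ r → 3 * (1 + r) + (1 + 3 * r + 2 * (r * r)) ≡ 2 * ((1 + r) * ((1 + r) * 1)) + 2 * (1 + r)
    expand r = solve (r ∷ [])

  2q²+2q≤order : 2 * q ^ 2 + 2 * q ≤ q ^ 2 * (2 * q + 3)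
  2q²+2q≤order = subst (λ n → 2 * n ^ 2 + 2 * n ≤ n ^ 2 * (2 * n + 3)) (suc-pred q)
    (≤-trans (m≤m+n _ (1 + 6 * pred q + 7 * (pred q * pred q) + 2 * (pred q * pred q * pred q)))
      (≤-reflexive (expand (pred q))))
    where
    expand : ∀ r → 2 * ((1 + r) * ((1 + r) * 1)) + 2 * (1 + r) + (1 + 6 * r + 7 * (r * r) + 2 * (r * r * r)) ≡
                   (1 + r) * ((1 + r) * 1) * (2 * (1 + r) + 3)
    expand r = solve (r ∷ [])

module ZeroOne {v : ℕ} (M : Matrix v) (M≤1 : ∀ x y → M x y ≤ 1) (q : ℕ) (F : Matrix v)
  (F≤1 : ∀ x y → F x y ≤ 1) (F-diagonal : ∀ x → F x x ≡ 0)
  (gram : ∀ x y → sum (λ z → M x z * M y z) ≡ gramForm q F x y) where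

  -- Entries 0 and 1 equal their squares, so a degree is a diagonal entry of the Gram matrix.
  degree : ∀ x → ∣ (λ z → M x z ≟ 1) ∣ ≡ 2 * q ^ 2 + 2 * q
  degree x = begin
    ∣ (λ z → M x z ≟ 1) ∣         ≡⟨ ∣∣≡sum (λ z → M x z ≟ 1) ⟩
    sum (λ z → 𝟙 (M x z ≟ 1))     ≡⟨ sum-cong v (λ z → sym (trans (square (M≤1 x z)) (𝟙-≡1 (M≤1 x z)))) ⟩
    sum (λ z → M x z * M x z)     ≡⟨ gram x x ⟩
    gramForm q F x x              ≡⟨ cong₂ (λ d f → 2 * q ^ 2 * d + 2 * q * 1 + q * f)
                                       (𝟙-true (x ≟ᶠ x) refl) (F-diagonal x) ⟩
    2 * q ^ 2 * 1 + 2 * q * 1 + q * 0  ≡⟨ simplify q ⟩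
    2 * q ^ 2 + 2 * q             ∎
    where
    square : ∀ {k} → k ≤ 1 → k * k ≡ k
    square z≤n       = refl
    square (s≤s z≤n) = refl
    simplify : ∀ q → 2 * (q * (q * 1)) * 1 + 2 * q * 1 + q * 0 ≡ 2 * (q * (q * 1)) + 2 * q
    simplify q = solve (q ∷ [])

  common : ∀ x y → ∣ (λ z → (M x z ≟ 1) ×-dec (M y z ≟ 1)) ∣ ≡ gramForm q F x y
  common x y = begin
    ∣ (λ z → (M x z ≟ 1) ×-dec (M y z ≟ 1)) ∣
      ≡⟨ ∣∣≡sum (λ z → (M x z ≟ 1) ×-dec (M y z ≟ 1)) ⟩
    sum (λ z → 𝟙 ((M x z ≟ 1) ×-dec (M y z ≟ 1)))
      ≡⟨ sum-cong v (λ z → sym (trans (cong₂ _*_ (𝟙-≡1 (M≤1 x z)) (𝟙-≡1 (M≤1 y z)))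
           (𝟙-× (M x z ≟ 1) (M y z ≟ 1)))) ⟩
    sum (λ z → M x z * M y z)
      ≡⟨ gram x y ⟩
    gramForm q F x y ∎

  common-values : ∀ x y → x ≢ y →
    let c = ∣ (λ z → (M x z ≟ 1) ×-dec (M y z ≟ 1)) ∣ in c ≡ 2 * q ⊎ c ≡ 3 * q
  common-values x y x≢y = helper (F≤1 x y)
    (trans (common x y) (cong (λ d → 2 * q ^ 2 * d + 2 * q * 1 + q * F x y) (𝟙-false (x ≟ᶠ y) x≢y)))
    where
    without : ∀ q → 2 * (q * (q * 1)) * 0 + 2 * q * 1 + q * 0 ≡ 2 * q
    without q = solve (q ∷ [])
    with-one : ∀ q → 2 * (q * (q * 1)) * 0 + 2 * q * 1 + q * 1 ≡ 3 * q
    with-one q = solve (q ∷ [])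
    helper : ∀ {c f} → f ≤ 1 → c ≡ 2 * q ^ 2 * 0 + 2 * q * 1 + q * f → c ≡ 2 * q ⊎ c ≡ 3 * q
    helper z≤n       eq = inj₁ (trans eq (without q))
    helper (s≤s z≤n) eq = inj₂ (trans eq (with-one q))

module _ {v : ℕ} (M : Matrix v) (M≤1 : ∀ x y → M x y ≤ 1) (M-diagonal : ∀ x → M x x ≡ 0)
  (q : ℕ) .{{_ : NonZero q}} (v≡ : v ≡ q ^ 2 * (2 * q + 3)) (F : Matrix v)
  (F≤1 : ∀ x y → F x y ≤ 1) (F-diagonal : ∀ x → F x x ≡ 0)
  (gram : ∀ x y → sum (λ z → M x z * M y z) ≡ gramForm q F x y) where

  open Bounds q
  private module Rows = ZeroOne M M≤1 q F F≤1 F-diagonal gram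

  M-irreflexive : ∀ {x y} → x ≡ y → M x y ≢ 1
  M-irreflexive {x} refl eq = contradiction (trans (sym (M-diagonal x)) eq) λ ()

  dezaGraph : (∀ x y → M x y ≡ M y x) →
    ∃[ G ] (IsDeza G (q ^ 2 * (2 * q + 3)) (2 * q ^ 2 + 2 * q) (3 * q) (2 * q)
            × M ≐ adjacencyMatrix (Graph._∼?_ G))
  dezaGraph M-sym =
    record
      { _∼_    = λ x y → M x y ≡ 1
      ; _∼?_   = λ x y → M x y ≟ 1
      ; irrefl = M-irreflexive
      ; sym    = λ {x} {y} eq → trans (M-sym y x) eq
      } ,
    record
      { order   = v≡
      ; a≤b     = 2q≤3q
      ; regular = Rows.degree
      ; common  = Rows.common-values
      } ,
    λ x y → 𝟙-≡1 (M≤1 x y)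

  -- The column products are required to have the same `F` as the row products: this makes the two
  -- neighbour counts coincide for each pair, not merely take the same two values.
  directedDezaGraph : (∀ x y → sum (λ z → M z x * M z y) ≡ gramForm q F x y) →
    ∃[ G ] (IsDirectedDezaII G (q ^ 2 * (2 * q + 3)) (2 * q ^ 2 + 2 * q) (3 * q) (2 * q)
            × M ≐ adjacencyMatrix (Digraph._⟶?_ G))
  directedDezaGraph gramᵗ =
    record
      { _⟶_    = λ x y → M x y ≡ 1
      ; _⟶?_   = λ x y → M x y ≟ 1
      ; irrefl = M-irreflexive
      } ,
    record
      { order      = v≡
      ; a≤b        = 2q≤3q
      ; b≤k        = 3q≤2q²+2q
      ; k≤n        = 2q²+2q≤order
      ; outRegular = Rows.degree
      ; inRegular  = Columns.degree
      ; common     = λ x y x≢y →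
          trans (Rows.common x y) (sym (Columns.common x y)) , Rows.common-values x y x≢y
      } ,
    λ x y → 𝟙-≡1 (M≤1 x y)
    where
    module Columns = ZeroOne (M ᵗ) (λ x y → M≤1 y x) q F F≤1 F-diagonal gramᵗ

-- The matrices of the construction

3+2q≡ : ∀ q → 3 + 2 * q ≡ suc (q + 1) + (q + 1)
3+2q≡ q = solve (q ∷ [])

2[2+q]≡1+[3+2q] : ∀ q → 2 * (2 + q) ≡ 1 + (3 + 2 * q)
2[2+q]≡1+[3+2q] q = solve (q ∷ [])

[3+2q]q²≡ : ∀ q → (3 + 2 * q) * (q * q) ≡ q * (q * 1) * (2 * q + 3)
[3+2q]q²≡ q = solve (q ∷ [])

-- The leading digit is split off first, as `_⊗_` does with the indices of `⨂U`.
digits : ∀ p k → Fin (p ^ k) ↔ Vec (Fin p) k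
digits p k = mk↔ₛ′ (to k) from to-from (from-to k)
  where
  open import Data.Vec.Base using ([]; _∷_)
  to : ∀ k → Fin (p ^ k) → Vec (Fin p) k
  to zero    s = []
  to (suc k) s = quotient {p} (p ^ k) s ∷ to k (remainder {p} (p ^ k) s)
  from : ∀ {k} → Vec (Fin p) k → Fin (p ^ k)
  from []       = zero
  from (x ∷ xs) = combine x (from xs)
  to-from : ∀ {k} (xs : Vec (Fin p) k) → to k (from xs) ≡ xs
  to-from []                = refl
  to-from {suc k} (x ∷ xs) = cong₂ _∷_ (cong proj₁ (remQuot-combine x (from xs)))
    (trans (cong (to k ∘ proj₂) (remQuot-combine x (from xs))) (to-from xs))
  from-to : ∀ k s → from (to k s) ≡ s
  from-to zero    zero = refl
  from-to (suc k) s    = trans (cong (combine (quotient {p} (p ^ k) s)) (from-to k (remainder {p} (p ^ k) s)))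
    (combine-remQuot {p} (p ^ k) s)

module Proof {p m : ℕ} .{{_ : NonZero p}} (1<p : 1 < p) (𝔽 : FiniteField p m)
  (a : Vector (Symbol (FiniteField.Carrier 𝔽)) (3 + 2 * p ^ m)) (firstRow : IsFirstRow (p ^ m) a)
  (φ : Colour (FiniteField.Carrier 𝔽) ⤖ Fin (1 + p ^ m)) (exponent : Construction.IsExponent 𝔽 a φ)
  where

  open import Data.Vec.Base using ([]; _∷_)
  open Construction 𝔽 a
  open FieldGeometry 𝔽 using (ring; module Counting)
  open GroupProperties (CommutativeRing.+-group ring) using ()
    renaming (⁻¹-involutive to -‿involutive; ε⁻¹≈ε to -0≡0)

  -- The numbering under which `ϕ α` becomes the matrix of translation by `α`; in general it differs
  -- from `elem`.
  points : Fin q ↔ Carrier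
  points = ↔-sym coords ↔-∘ digits p m

  open Counting elem points

  -- Each factor shifts its own digit cyclically, and a Kronecker product of zero-one matrices has a
  -- one exactly where all factors do.
  ⨂U-entry : ∀ {k} (v : Vec (Fin p) k) (s t : Fin (p ^ k)) → let open Inverse (digits p k) in
    ⨂U v s t ≡ 𝟙 (VecP.≡-dec _≟ᶠ_ (zipWith (λ i j → (toℕ i + toℕ j) mod p) (to s) v) (to t))
  ⨂U-entry []                zero zero = refl
  ⨂U-entry {suc k} (i ∷ is) s t = begin
    (U ^ᴹ toℕ i) s₁ t₁ * ⨂U is s₂ t₂
      ≡⟨ cong₂ _*_ (Cyclic.Shift.shift-^ p 1<p (toℕ i) s₁ t₁) (⨂U-entry is s₂ t₂) ⟩
    𝟙 head? * 𝟙 tail?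
      ≡⟨ 𝟙-× head? tail? ⟩
    𝟙 (head? ×-dec tail?)
      ≡⟨ 𝟙-cong (head? ×-dec tail?) all? (uncurry (cong₂ _∷_)) VecP.∷-injective ⟩
    𝟙 all? ∎
    where
    add : Fin p → Fin p → Fin p
    add i j = (toℕ i + toℕ j) mod p
    s₁ = quotient {p} (p ^ k) s
    t₁ = quotient {p} (p ^ k) t
    s₂ = remainder {p} (p ^ k) s
    t₂ = remainder {p} (p ^ k) t
    head? = (toℕ s₁ + toℕ i) mod p ≟ᶠ t₁
    tail? = VecP.≡-dec _≟ᶠ_ (zipWith add (Inverse.to (digits p k) s₂) is) (Inverse.to (digits p k) t₂)
    all?  = VecP.≡-dec _≟ᶠ_ (zipWith add (Inverse.to (digits p (suc k)) s) (i ∷ is))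
                           (Inverse.to (digits p (suc k)) t)

  ϕ-entry : ∀ α s t → ϕ α s t ≡ 𝟙 ((y s +ᶠ α) ≟ᴷ y t)
  ϕ-entry α s t = trans (⨂U-entry (Coords.to α) s t)
    (𝟙-cong (VecP.≡-dec _≟ᶠ_ translated (Digits.to t)) ((y s +ᶠ α) ≟ᴷ y t)
      (λ eq → trans (sym (Coords.strictlyInverseʳ (y s +ᶠ α))) (cong Coords.from (trans translate eq)))
      (λ eq → trans (sym translate) (trans (cong Coords.to eq) (Coords.strictlyInverseˡ (Digits.to t)))))
    where
    module Coords = Inverse coords
    module Digits = Inverse (digits p m)
    add : Fin p → Fin p → Fin p
    add i j = (toℕ i + toℕ j) mod p
    translated : Vec (Fin p) m
    translated = zipWith add (Digits.to s) (Coords.to α)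
    translate : Coords.to (y s +ᶠ α) ≡ translated
    translate = trans (coords-+ (y s) α)
      (cong (λ v → zipWith add v (Coords.to α)) (Coords.strictlyInverseˡ (Digits.to s)))

  block offset : Fin (q * q) → Fin q
  block  = quotient {q} q
  offset = remainder {q} q

  C-entry : ∀ c α X Y → C c α X Y ≡ 𝟙 (hit? c α (block X) (offset X) (block Y) (offset Y))
  C-entry 𝕪       α X Y = trans (*-identityʳ _) (ϕ-entry α (block X) (block Y))
  C-entry (elt b) α X Y = ϕ-entry (b *ᶠ (-ᶠ x (block X) +ᶠ x (block Y)) +ᶠ α) (offset X) (offset Y)

  C≤1 : ∀ c α X Y → C c α X Y ≤ 1
  C≤1 c α X Y = ≤-trans (≤-reflexive (C-entry c α X Y))
    (𝟙≤1 (hit? c α (block X) (offset X) (block Y) (offset Y)))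

  C-transpose : ∀ c α X Y → C c α X Y ≡ C c (-ᶠ α) Y X
  C-transpose c α X Y = begin
    C c α X Y
      ≡⟨ C-entry c α X Y ⟩
    𝟙 (hit? c α i s j t)
      ≡⟨ 𝟙-cong (hit? c α i s j t) (hit? c (-ᶠ α) j t i s) (Hit-transpose c α i s j t)
           (λ h → subst (λ β → Hit c β i s j t) (-‿involutive α) (Hit-transpose c (-ᶠ α) j t i s h)) ⟩
    𝟙 (hit? c (-ᶠ α) j t i s)
      ≡⟨ sym (C-entry c (-ᶠ α) Y X) ⟩
    C c (-ᶠ α) Y X ∎
    where
    i = block X
    s = offset X
    j = block Y
    t = offset Y

  C-product : ∀ c d α X Y →
    sum (λ Z → C c α X Z * C d α Y Z) ≡ common c d α (block X) (offset X) (block Y) (offset Y)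
  C-product c d α X Y = trans
    (sum-cong (q * q) λ Z → cong₂ _*_ (C-entry c α X Z) (C-entry d α Y Z))
    (sum-remQuot q q λ j t → 𝟙 (hit? c α (block X) (offset X) j t) * 𝟙 (hit? d α (block Y) (offset Y) j t))

  -- With `𝕪` at index zero, a sum over `Fin (1 + q)` unfolds to the two summands of `Σ-colour`, so
  -- `N α` and `F` are such sums by computation.
  colour : Fin (1 + q) → Colour Carrier
  colour zero    = 𝕪
  colour (suc k) = elt (x k)

  colour-injective : ∀ {k l} → colour k ≡ colour l → k ≡ l
  colour-injective {zero}  {zero}  eq = refl
  colour-injective {suc k} {suc l} eq = cong suc (x-injective (elt-injective eq))
    where
    elt-injective : ∀ {α β : Carrier} → elt α ≡ elt β → α ≡ β
    elt-injective refl = refl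

  C-total : ∀ X Y → sum (λ k → C (colour k) 0# X Y) ≡ 1 + q * 𝟙 (X ≟ᶠ Y)
  C-total X Y = begin
    sum (λ k → C (colour k) 0# X Y)
      ≡⟨ sum-cong (1 + q) {λ k → C (colour k) 0# X Y} {λ k → 𝟙 (hit? (colour k) 0# _ _ _ _)}
           (λ k → C-entry (colour k) 0# X Y) ⟩
    sum (λ k → 𝟙 (hit? (colour k) 0# (block X) (offset X) (block Y) (offset Y)))
      ≡⟨ lines (block X) (offset X) (block Y) (offset Y) ⟩
    1 + q * (𝟙 (block X ≟ᶠ block Y) * 𝟙 (offset X ≟ᶠ offset Y))
      ≡⟨ cong (λ d → 1 + q * d) (sym (I-blocks q q X Y)) ⟩
    1 + q * 𝟙 (X ≟ᶠ Y) ∎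

  open Cyclic ℓ using (difference; ⊞-difference≡0; difference-self; W; W-sym; W-W; module Halving; module Shift)
  open Shift (s≤s (s≤s z≤n)) using (shift-W)
  open IsFirstRow firstRow

  row-low : ∀ k → 1 ≤ toℕ k → toℕ k ≤ q + 1 → a k ≢ 𝕩
  row-low (suc zero)        _ _   eq = contradiction (trans (sym second) eq) λ ()
  row-low k@(suc (suc k′)) _ k≤ eq =
    contradiction (trans (sym (proj₂ (fieldPart k (s≤s (s≤s z≤n)) k≤))) eq) λ ()

  -- Positions beyond `q + 1` are reflected by `palindrome` to `ℓ ∸ k`. Since `ℓ` is
  -- `(q + 2) + (q + 1)`, the mirror image lies between 1 and `q + 1`, where `row-low` applies.
  row-nonzero : ∀ k → toℕ k ≢ 0 → a k ≢ 𝕩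
  row-nonzero k k≢0 with toℕ k ≤? q + 1
  ... | yes k≤q+1 = row-low k (n≢0⇒n>0 k≢0) k≤q+1
  ... | no  k≰q+1 = λ eq → row-low k′
        (≤-trans (m<n⇒0<n∸m (toℕ<n k)) (≤-reflexive (sym toℕ-k′)))
        (≤-trans (≤-reflexive toℕ-k′) (≤-trans (∸-monoʳ-≤ ℓ (≰⇒> k≰q+1)) (≤-reflexive middle)))
        (trans (sym (palindrome k k′ (trans (cong (toℕ k +_) toℕ-k′) (m+[n∸m]≡n (<⇒≤ (toℕ<n k)))))) eq)
    where
    k′<ℓ : ℓ ∸ toℕ k < ℓ
    k′<ℓ = ∸-monoʳ-< (n≢0⇒n>0 k≢0) (<⇒≤ (toℕ<n k))
    k′ : Fin ℓ
    k′ = fromℕ< k′<ℓ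
    toℕ-k′ : toℕ k′ ≡ ℓ ∸ toℕ k
    toℕ-k′ = toℕ-fromℕ< k′<ℓ
    middle : ℓ ∸ suc (q + 1) ≡ q + 1
    middle = trans (cong (_∸ suc (q + 1)) (3+2q≡ q)) (m+n∸m≡n (suc (q + 1)) (q + 1))

  colours-total : ∀ s → sum (λ k → 𝟙 (≟-symbol _≟ᴷ_ s (col (colour k)))) + 𝟙 (≟-symbol _≟ᴷ_ s 𝕩) ≡ 1
  colours-total 𝕩             = cong (_+ 1) (sum-≡0 {q} _ λ _ → refl)
  colours-total (col 𝕪)       = cong (λ n → suc n + 0) (sum-≡0 {q} _ λ _ → refl)
  colours-total (col (elt α)) = trans (+-identityʳ _)
    (sum-↔-𝟙 elem (λ β → ≟-symbol _≟ᴷ_ (col (elt α)) (col (elt β))) α refl λ { _ refl → refl })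

  L≡𝕩⇒≡ : ∀ i j → L i j ≡ 𝕩 → i ≡ j
  L≡𝕩⇒≡ i j eq = ⊞-difference≡0
    (decidable-stable (toℕ (difference i j) ≟ 0) (λ ≢0 → row-nonzero (difference i j) ≢0 eq))

  L-diagonal : ∀ i j → i ≡ j → L i j ≡ 𝕩
  L-diagonal i j refl = trans (cong a (toℕ-injective {j = zero} (difference-self i))) first

  -- Each entry of `L` is exactly one symbol, and `𝕩` occurs precisely on the diagonal, so the
  -- identity can be traded for the indicator of `𝕩`.
  P-total : Decomposes (λ k → P (col (colour k)))
  P-total i j = trans
    (cong (λ d → sum (λ k → P (col (colour k)) i j) + d)
      (𝟙-cong (i ≟ᶠ j) (≟-symbol _≟ᴷ_ (L i j) 𝕩) (L-diagonal i j) (L≡𝕩⇒≡ i j)))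
    (colours-total (L i j))

  P-pattern : ∀ c → P (col c) ≐ W (value φ c)
  P-pattern c i j = trans (exponent c i j) (shift-W (value φ c) i j)

  Q : Colour Carrier → Matrix ℓ
  Q c = V ^ᴾ (ℤ.+ (2 * value φ c)) ⊕ V ^ᴾ (ℤ.- ℤ.+ (2 * value φ c))

  P-square : ∀ c i j → sum (λ k → P (col c) i k * P (col c) j k) ≡ Q c i j + 2 * 𝟙 (i ≟ᶠ j)
  P-square c i j = begin
    sum (λ k → P (col c) i k * P (col c) j k)
      ≡⟨ sum-cong ℓ {λ k → P (col c) i k * P (col c) j k} (λ k → cong₂ _*_ (P-pattern c i k) (P-pattern c j k)) ⟩
    sum (λ k → W v i k * W v j k)
      ≡⟨ W-W v i j ⟩
    W (2 * v) i j + 2 * 𝟙 (i ≟ᶠ j)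
      ≡⟨ cong (_+ 2 * 𝟙 (i ≟ᶠ j)) (sym (shift-W (2 * v) i j)) ⟩
    Q c i j + 2 * 𝟙 (i ≟ᶠ j) ∎
    where v = value φ c

  -- `2 + q` is `(ℓ + 1) / 2`, the inverse of 2 modulo `ℓ`.
  open Halving (2 + q) (2[2+q]≡1+[3+2q] q) using (half; half-injective; W-half)

  Q-total : Decomposes (λ k → Q (colour k))
  Q-total i j = begin
    sum (λ k → Q (colour k) i j) + 𝟙 (i ≟ᶠ j)
      ≡⟨ cong₂ _+_
           (sum-cong (1 + q) {λ k → Q (colour k) i j} {λ k → P (col (colour k)) (half i) (half j)} λ k →
             trans (shift-W (2 * value φ (colour k)) i j)
               (trans (W-half (value φ (colour k)) i j) (sym (P-pattern (colour k) (half i) (half j)))))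
           (𝟙-cong (i ≟ᶠ j) (half i ≟ᶠ half j) (cong half) half-injective) ⟩
    sum (λ k → P (col (colour k)) (half i) (half j)) + 𝟙 (half i ≟ᶠ half j)
      ≡⟨ P-total (half i) (half j) ⟩
    1 ∎

  v : ℕ
  v = ℓ * (q * q)

  row : Fin v → Fin ℓ
  row = quotient {ℓ} (q * q)

  inner : Fin v → Fin (q * q)
  inner = remainder {ℓ} (q * q)

  F : Matrix v
  F = Σ-colour λ c → Q c ⊗ C c 0#

  N-gram : ∀ α X Y → (N α · N α ᵗ) X Y ≡ gramForm q F X Y
  N-gram α X Y = begin
    sum (λ Z → N α X Z * N α Y Z)
      ≡⟨ sum-remQuot ℓ (q * q) (λ k Z → entry (row X) (inner X) k Z * entry (row Y) (inner Y) k Z) ⟩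
    sum (λ k → sum (λ Z → entry (row X) (inner X) k Z * entry (row Y) (inner Y) k Z))
      ≡⟨ Product.gram {ℓ} {q * q} {1 + q} q refl refl
           {λ k → P (col (colour k))} {λ k → Q (colour k)} P-total Q-total (λ k → P-square (colour k))
           {λ k → C (colour k) α} {λ k → C (colour k) 0#}
           (λ k X Y → trans (C-product (colour k) (colour k) α X Y)
             (trans (common-same (colour k) α _ _ _ _) (cong (q *_) (sym (C-entry (colour k) 0# X Y)))))
           (λ {k} {l} k≢l X Y → trans (C-product (colour k) (colour l) α X Y)
             (common-distinct (λ eq → k≢l (colour-injective eq)) α _ _ _ _))
           C-total (row X) (row Y) (inner X) (inner Y) ⟩
    2 * q ^ 2 * (𝟙 (row X ≟ᶠ row Y) * 𝟙 (inner X ≟ᶠ inner Y)) + 2 * q * 1 + q * F X Y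
      ≡⟨ cong (λ d → 2 * q ^ 2 * d + 2 * q * 1 + q * F X Y) (sym (I-blocks ℓ (q * q) X Y)) ⟩
    gramForm q F X Y ∎
    where
    entry : Fin ℓ → Fin (q * q) → Fin ℓ → Fin (q * q) → ℕ
    entry i X k Z = sum (λ l → P (col (colour l)) i k * C (colour l) α X Z)

  N≤1 : ∀ α X Y → N α X Y ≤ 1
  N≤1 α X Y = weighted≤1 (λ k → P (col (colour k))) P-total
    (λ k → C (colour k) α (inner X) (inner Y)) (λ k → C≤1 (colour k) α (inner X) (inner Y)) (row X) (row Y)

  N-diagonal : ∀ α X → N α X X ≡ 0
  N-diagonal α X = weighted-diagonal (λ k → P (col (colour k))) P-total
    (λ k → C (colour k) α (inner X) (inner X)) (λ k → C≤1 (colour k) α (inner X) (inner X)) (row X)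

  F≤1 : ∀ X Y → F X Y ≤ 1
  F≤1 X Y = weighted≤1 (λ k → Q (colour k)) Q-total
    (λ k → C (colour k) 0# (inner X) (inner Y)) (λ k → C≤1 (colour k) 0# (inner X) (inner Y)) (row X) (row Y)

  F-diagonal : ∀ X → F X X ≡ 0
  F-diagonal X = weighted-diagonal (λ k → Q (colour k)) Q-total
    (λ k → C (colour k) 0# (inner X) (inner X)) (λ k → C≤1 (colour k) 0# (inner X) (inner X)) (row X)

  N-transpose : ∀ α X Y → N α X Y ≡ N (-ᶠ α) Y X
  N-transpose α X Y = cong₂ _+_ (term 𝕪) (sum-cong q λ k → term (elt (x k)))
    where
    term : ∀ c → (P (col c) ⊗ C c α) X Y ≡ (P (col c) ⊗ C c (-ᶠ α)) Y X
    term c = cong₂ _*_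
      (trans (P-pattern c (row X) (row Y))
        (trans (W-sym (value φ c) (row X) (row Y)) (sym (P-pattern c (row Y) (row X)))))
      (C-transpose c α (inner X) (inner Y))

  instance
    q-nonZero : NonZero q
    q-nonZero = m^n≢0 p m

  v≡ : v ≡ q ^ 2 * (2 * q + 3)
  v≡ = [3+2q]q²≡ q

  deza : ∃[ G ] (IsDeza G (q ^ 2 * (2 * q + 3)) (2 * q ^ 2 + 2 * q) (3 * q) (2 * q)
                 × N 0# ≐ adjacencyMatrix (Graph._∼?_ G))
  deza = dezaGraph (N 0#) (N≤1 0#) (N-diagonal 0#) q v≡ F F≤1 F-diagonal (N-gram 0#)
    (λ X Y → trans (N-transpose 0# X Y) (cong (λ β → N β Y X) -0≡0))

  directedDeza : ∀ α → ∃[ G ] (IsDirectedDezaII G (q ^ 2 * (2 * q + 3)) (2 * q ^ 2 + 2 * q) (3 * q) (2 * q)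
                               × N α ≐ adjacencyMatrix (Digraph._⟶?_ G))
  directedDeza α = directedDezaGraph (N α) (N≤1 α) (N-diagonal α) q v≡ F F≤1 F-diagonal (N-gram α)
    (λ X Y → trans (sum-cong v λ Z → cong₂ _*_ (N-transpose α Z X) (N-transpose α Z Y)) (N-gram (-ᶠ α) X Y))

open import Data.Integer.Base using (+_)

corollary5p8 : (p m : ℕ) .{{_ : NonZero p}} → Prime p → 2 ∤ p →
    (𝔽 : FiniteField p m) →
    (a : Vector (Symbol (FiniteField.Carrier 𝔽)) (3 + 2 * p ^ m)) → IsFirstRow (p ^ m) a →
    let open Construction 𝔽 a in
    (φ : Colour Carrier ⤖ Fin (1 + q)) → IsExponent φ →
    (∀ α →
    N α · N α ᵗ ≐
    (2 * q ^ 2) ⊙ I (ℓ * (q * q)) ⊕ (2 * q) ⊙ J (ℓ * (q * q))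
    ⊕ q ⊙ Σ-colour (λ c →
    (V ^ᴾ (+ (2 * value φ c)) ⊕ V ^ᴾ (ℤ.- + (2 * value φ c))) ⊗ C c 0#))
    × (∃[ G ] (IsDeza G (q ^ 2 * (2 * q + 3)) (2 * q ^ 2 + 2 * q) (3 * q) (2 * q)
    × N 0# ≐ adjacencyMatrix (Graph._∼?_ G)))
    × (∀ α → α ≢ 0# →
    ∃[ G ] (IsDirectedDezaII G (q ^ 2 * (2 * q + 3)) (2 * q ^ 2 + 2 * q) (3 * q) (2 * q)
    × N α ≐ adjacencyMatrix (Digraph._⟶?_ G)))
corollary5p8 p m p-prime _ 𝔽 a firstRow φ exponent = N-gram , deza , λ α _ → directedDeza α
  where
  1<p : 1 < p
  1<p = nonTrivial⇒n>1 p {{prime⇒nonTrivial p-prime}}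
  open Proof 1<p 𝔽 a firstRow φ exponent
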